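{- For every pair of natural numbers $k$ and $r$, the family of graphs that are $C_{\geq r}$-free, $k$-theta-free, $k$-prism-free, and $k$-pyramid-free is tame.
   Context: All graphs are finite, simple and undirected. The length of a path or cycle is its number of vertices. Two disjoint vertex sets are anti-complete if there is no edge between them. $G$ is $C_{\ge r}$-free if it contains no induced cycle of length at least $r$. $G$ is $k$-theta-free (resp. $k$-prism-free, $k$-pyramid-free) if no induced subgraph of $G$ is a $k$-theta (resp. $k$-prism, $k$-pyramid). Minimal separator of $G$: a non-empty $S\subseteq V(G)$ such that $G-S$ has at least two distinct connected components $L,R$ with $N_G(L)=N_G(R)=S$. A family $\mathcal F$ is tame if there is a constant $c$ such that every $G\in\mathcal F$ has at most $|V(G)|^c$ minimal separators. In the following, the graph has exactly the vertices and edges described. $k$-theta: two vertices $a,b$ and $k$ induced paths $P_1,\dots,P_k$, each with endpoints $a$ and $b$ and length at least 4, with $P_i-\{a,b\}$ and $P_j-\{a,b\}$ disjoint and anti-complete for $i\neq j$. $k$-prism: two disjoint cliques $\{a_1,\dots,a_k\}$ and $\{b_1,\dots,b_k\}$ and $k$ disjoint induced paths $P_1,\dots,P_k$, each of length at least 2, where $P_i$ has endpoints $a_i,b_i$; the only edges between distinct $P_i,P_j$ are $a_ia_j$ and $b_ib_j$. $k$-pyramid: a vertex $a$, a clique $\{b_1,\dots,b_k\}$ anti-complete with $a$, and $k$ induced paths $P_1,\dots,P_k$, each of length at least 3, where $P_i$ has endpoints $a,b_i$; the paths are disjoint apart from $a$, and the only edge between $P_i-a$ and $P_j-a$ for $i\ne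 j$ is $b_ib_j$. -}

module Defs where

open import Data.Fin using (Fin; zero; suc; toℕ; fromℕ)
open import Data.Fin.Subset using (Subset; _∈_; _∉_; ∁; Nonempty)
open import Data.List using (length)
open import Data.List.Relation.Unary.All using (All)
open import Data.List.Relation.Unary.Unique.Propositional using (Unique)
open import Data.Nat using (ℕ; suc; _+_; _^_; _≤_)
open import Data.Nat.Properties using (_≟_; 1+n≢n)
open import Data.Product using (∃-syntax; _×_; _,_)
open import Data.Sum using (_⊎_; inj₁; inj₂; swap)
open import Function using (_⇔_; Injective)
open import Level using (0ℓ)
open import Relation.Binary using (Rel; Symmetric; Decidable)
open import Relation.Binary.Construct.Closure.ReflexiveTransitive using (Star)
open import Relation.Binary.PropositionalEquality using (_≡_; _≢_)
open import Relation.Nullary using (¬_; _×-dec_; _⊎-dec_)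
open import Relation.Unary using (Pred; _⊥_; _≐_)

record Graph : Set₁ where
  field
    order  : ℕ
  Vertex : Set
  Vertex = Fin order
  field
    Adj        : Rel Vertex 0ℓ
    adj?       : Decidable Adj
    adj-sym    : Symmetric Adj
    adj-irrefl : ∀ v → ¬ Adj v v

open Graph public

-- H ⊑ G : H is isomorphic to an induced subgraph of G.
record _⊑_ (H G : Graph) : Set where
  field
    to        : Vertex H → Vertex G
    injective : Injective _≡_ _≡_ to
    adj⇔adj   : ∀ u v → Adj H u v ⇔ Adj G (to u) (to v)

open _⊑_ public

NoInduced : (Graph → Set) → Graph → Set₁
NoInduced F G = ∀ H → F H → ¬ (H ⊑ G)

-- Anti-completeness is only defined for disjoint sets, hence the first factor.
AntiComplete : (G : Graph) → Pred (Vertex G) 0ℓ → Pred (Vertex G) 0ℓ → Set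
AntiComplete G P Q = P ⊥ Q × (∀ {u v} → P u → Q v → ¬ Adj G u v)

N : (G : Graph) → Subset (order G) → Pred (Vertex G) 0ℓ
N G X v = v ∉ X × ∃[ u ] (u ∈ X × Adj G u v)

pathGraph : ℕ → Graph
pathGraph n = record
  { order      = n
  ; Adj        = λ i j → Next i j ⊎ Next j i
  ; adj?       = λ i j → next? i j ⊎-dec next? j i
  ; adj-sym    = swap
  ; adj-irrefl = λ { i (inj₁ p) → 1+n≢n p ; i (inj₂ p) → 1+n≢n p }
  }
  where
  Next : Rel (Fin n) 0ℓ
  Next i j = suc (toℕ i) ≡ toℕ j

  next? : Decidable Next
  next? i j = suc (toℕ i) ≟ toℕ j

-- Indexed from the triangle: the length of cycleGraph m is 3 + m.
cycleGraph : ℕ → Graph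
cycleGraph m = record
  { order      = 3 + m
  ; Adj        = λ i j → Next i j ⊎ Next j i
  ; adj?       = λ i j → next? i j ⊎-dec next? j i
  ; adj-sym    = swap
  ; adj-irrefl = λ { i (inj₁ p) → next-irrefl i p ; i (inj₂ p) → next-irrefl i p }
  }
  where
  Next : Rel (Fin (3 + m)) 0ℓ
  Next i j = suc (toℕ i) ≡ toℕ j ⊎ (suc (toℕ i) ≡ 3 + m × toℕ j ≡ 0)

  next? : Decidable Next
  next? i j = (suc (toℕ i) ≟ toℕ j) ⊎-dec ((suc (toℕ i) ≟ 3 + m) ×-dec (toℕ j ≟ 0))

  next-irrefl : ∀ i → ¬ Next i i
  next-irrefl i (inj₁ p) = 1+n≢n p
  next-irrefl zero (inj₂ (() , _))
  next-irrefl (suc i) (inj₂ (_ , ()))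

C≥Free : ℕ → Graph → Set
C≥Free r G = ∀ m → r ≤ 3 + m → ¬ (cycleGraph m ⊑ G)

record InducedPath (G : Graph) (u v : Vertex G) : Set where
  field
    edgeCount : ℕ
    embedding : pathGraph (suc edgeCount) ⊑ G
    start     : to embedding zero ≡ u
    end       : to embedding (fromℕ edgeCount) ≡ v

open InducedPath public

-- The length of a path is its number of vertices.
len : ∀ {G u v} → InducedPath G u v → ℕ
len P = suc (edgeCount P)

V : ∀ {G u v} → InducedPath G u v → Pred (Vertex G) 0ℓ
V P w = ∃[ s ] to (embedding P) s ≡ w

IsClique : ∀ {k} (G : Graph) → (Fin k → Vertex G) → Set
IsClique G a = ∀ {i j} → i ≢ j → Adj G (a i) (a j)

-- The field `edges` follows from the others unless k = 0, where it says
-- that a and b are not adjacent. The corresponding condition is always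
-- redundant for prisms and pyramids, because `covers` and `cross` together
-- with the inducedness of the paths already determine all edges.
record IsTheta (k : ℕ) (H : Graph) : Set where
  field
    a b       : Vertex H
    a≢b       : a ≢ b
    path      : Fin k → InducedPath H a b
    length≥4  : ∀ i → 4 ≤ len (path i)
    interiors : ∀ {i j} → i ≢ j →
                AntiComplete H (λ v → V (path i) v × v ≢ a × v ≢ b)
                               (λ v → V (path j) v × v ≢ a × v ≢ b)
    covers    : ∀ v → v ≡ a ⊎ v ≡ b ⊎ ∃[ i ] V (path i) v
    edges     : ∀ {u v} → Adj H u v → ∃[ i ] (V (path i) u × V (path i) v)

record IsPrism (k : ℕ) (H : Graph) : Set where
  field
    a b       : Fin k → Vertex H
    a-clique  : IsClique H a
    b-clique  : IsClique H b
    a≢b       : ∀ i j → a i ≢ b j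
    path      : ∀ i → InducedPath H (a i) (b i)
    length≥2  : ∀ i → 2 ≤ len (path i)
    disjoint  : ∀ {i j} → i ≢ j → V (path i) ⊥ V (path j)
    cross     : ∀ {i j u v} → i ≢ j → V (path i) u → V (path j) v → Adj H u v →
                (u ≡ a i × v ≡ a j) ⊎ (u ≡ b i × v ≡ b j)
    covers    : ∀ v → ∃[ i ] V (path i) v

record IsPyramid (k : ℕ) (H : Graph) : Set where
  field
    a              : Vertex H
    b              : Fin k → Vertex H
    b-clique       : IsClique H b
    a-anticomplete : AntiComplete H (_≡ a) (λ v → ∃[ i ] b i ≡ v)
    path           : ∀ i → InducedPath H a (b i)
    length≥3       : ∀ i → 3 ≤ len (path i)
    disjoint       : ∀ {i j v} → i ≢ j → V (path i) v → V (path j) v → v ≡ a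
    cross          : ∀ {i j u v} → i ≢ j →
                     V (path i) u → u ≢ a → V (path j) v → v ≢ a →
                     Adj H u v → u ≡ b i × v ≡ b j
    covers         : ∀ v → v ≡ a ⊎ ∃[ i ] V (path i) v

ThetaFree PrismFree PyramidFree : ℕ → Graph → Set₁
ThetaFree k   = NoInduced (IsTheta k)
PrismFree k   = NoInduced (IsPrism k)
PyramidFree k = NoInduced (IsPyramid k)

AdjWithin : (G : Graph) → Subset (order G) → Rel (Vertex G) 0ℓ
AdjWithin G U u v = u ∈ U × v ∈ U × Adj G u v

IsComponent : (G : Graph) (U C : Subset (order G)) → Set
IsComponent G U C =
  ∃[ v ] (v ∈ U × (_∈ C) ≐ Star (AdjWithin G U) v)

record IsMinimalSeparator (G : Graph) (S : Subset (order G)) : Set where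
  field
    nonempty    : Nonempty S
    L R         : Subset (order G)
    L-component : IsComponent G (∁ S) L
    R-component : IsComponent G (∁ S) R
    L≢R         : L ≢ R
    N[L]≐S      : N G L ≐ (_∈ S)
    N[R]≐S      : N G R ≐ (_∈ S)

-- Counts through duplicate-free lists, so P need not be decidable or
-- proof-irrelevant.
AtMost : ∀ {n} → ℕ → (Subset n → Set) → Set
AtMost m P = ∀ Ss → Unique Ss → All P Ss → length Ss ≤ m

Tame : (Graph → Set₁) → Set₁
Tame F = ∃[ c ] (∀ G → F G → AtMost (order G ^ c) (IsMinimalSeparator G))

{-# OPTIONS --safe #-}

-- Let S be a minimal separator with full components L and R, and let Y be
-- an inclusion-minimal connected subset of R dominating S. For q ≠ v in Y
-- the component C of v in Y − q fails to dominate S, so some s ∈ S sends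
-- all its edges to Y into Y ∖ C, and an induced path, the leg of q,
-- runs from q to s through Y ∖ C. Legs of different q are anticomplete
-- except at their ends.
--
-- An induced path in Y extends by a leg at either end, and closes through
-- L to an induced cycle; so C≥r-freeness bounds the length of induced paths
-- in Y, and Y is bounded unless some v ∈ Y has many neighbours in Y. In that
-- case Ramsey's theorem makes these neighbours, and the ends in S of their
-- legs, cliques or stable sets. If the ends form a clique, there is a pyramid
-- or a prism. If they are stable, the same alternative for a minimal
-- connected subset Z of L dominating the ends gives legs into L (when Z is
-- bounded, a single vertex of Z sees many ends), and the two families
-- of legs combine to a theta, a pyramid or a prism.
--
-- So S is dominated by boundedly many vertices of L, and likewise of R, and
-- S is the set of common neighbours of the two dominating sets.
module Submission where

open import Defs
open import Data.Empty using (⊥-elim; ⊥)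
open import Data.Fin
  using (Fin; zero; suc; toℕ; fromℕ; inject≤; splitAt; _↑ˡ_; _↑ʳ_; finToFun; funToFin)
open import Data.Fin.Properties
  using (toℕ-injective; toℕ-fromℕ; inject≤-injective; injective⇒≤; ¬∀⟶∃¬; splitAt-↑ˡ;
         splitAt-↑ʳ; finToFun-funToFin)
  renaming (_≟_ to _≟ᶠ_; any? to anyᶠ?; all? to allᶠ?)
open import Data.Fin.Subset using (Subset; _∈_; _∉_; _⊆_; _⊂_; _∪_; _∩_; ∁; ⁅_⁆)
open import Data.Fin.Subset.Induction using (⊃-wellFounded; ⊂-wellFounded; Acc; acc)
open import Data.Fin.Subset.Properties
  using (_∈?_; _⊆?_; _⊂?_; anySubset?; x∈⁅x⁆; x∈⁅y⁆⇒x≡y; x∈p∪q⁻; p⊆p∪q; q⊆p∪q; x∈p∩q⁺; x∈p∩q⁻;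
         x∉p⇒x∈∁p; x∈∁p⇒x∉p; ⊆-antisym)
open import Data.List
  using (List; []; _∷_; _++_; length; lookup; map; [_]; filter; allFin; concatMap)
open import Data.List.Membership.Propositional using (find) renaming (_∈_ to _∈ˡ_; _∉_ to _∉ˡ_)
open import Data.List.Membership.Propositional.Properties
  using (∈-++⁻; ∈-++⁺ˡ; ∈-++⁺ʳ; ∈-lookup; ∈-map⁺; ∈-map⁻; ∈-filter⁺; ∈-filter⁻; ∈-allFin;
         ∈-concatMap⁺; ∈-concatMap⁻)
open import Data.List.Properties using (length-++; length-map; length-tabulate)
open import Data.List.Relation.Unary.All as All using (All; []; _∷_)
open import Data.List.Relation.Unary.AllPairs using (AllPairs; []; _∷_)
open import Data.List.Relation.Unary.Any as Any using (Any; here; there; any?; index)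
open import Data.List.Relation.Unary.Any.Properties using (lookup-index)
open import Data.List.Relation.Unary.Unique.Propositional using (Unique)
open import Data.List.Relation.Unary.Unique.Propositional.Properties using (allFin⁺; filter⁺)
open import Data.Nat using (ℕ; zero; suc; _+_; _≤_; z≤n; s≤s; _*_; _<_; _^_)
open import Data.Nat.Properties
  using (suc-injective; +-comm; m≤n+m; ≤-trans; +-mono-≤; ≤-reflexive; ≤-refl; +-suc; _≤?_;
         ≰⇒>; <⇒≱; +-mono-<; m≤m+n; *-monoˡ-≤; <⇒≤)
open import Data.Product using (∃-syntax; _×_; _,_; proj₁; proj₂; Σ-syntax)
open import Data.Sum using (_⊎_; inj₁; inj₂; [_,_]′; swap)
open import Data.Vec using (tabulate)
open import Data.Vec.Properties using (lookup∘tabulate; lookup⇒[]=; []=⇒lookup)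
open import Function using (_∘_; mk⇔; Injective)
open import Level using (0ℓ)
open import Relation.Binary using (Rel; Symmetric; Decidable)
open import Relation.Binary.Construct.Closure.ReflexiveTransitive as Star
  using (Star; ε; _◅_; _◅◅_)
open import Relation.Binary.PropositionalEquality
  using (_≡_; _≢_; refl; sym; trans; cong; subst; cong₂; subst₂)
open import Relation.Nullary using (¬_; Dec; yes; no; contradiction; ¬?; _×-dec_; map′; does)
open import Relation.Nullary.Decidable using (dec-true)
open import Relation.Unary using (Pred)
import Relation.Unary as U

-- Induced paths

module Paths (G : Graph) where

  -- Excluding `Touch` between two sets says at once that they are disjoint and that no edge joins
  -- them.
  Touch : Rel (Vertex G) 0ℓ
  Touch x y = x ≡ y ⊎ Adj G x y

  touch-sym : ∀ {x y} → Touch x y → Touch y x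
  touch-sym (inj₁ e) = inj₁ (sym e)
  touch-sym (inj₂ a) = inj₂ (adj-sym G a)

  -- IPath u xs w: the vertices u ∷ xs form, in this order, an induced path
  -- from u to w, so length xs is its number of edges.
  data IPath : Vertex G → List (Vertex G) → Vertex G → Set where
    stop : ∀ {v} → IPath v [] v
    step : ∀ {u v w xs} → Adj G u v →
           (∀ {x} → x ∈ˡ v ∷ xs → u ≢ x × (Adj G u x → x ≡ v)) →
           IPath v xs w → IPath u (v ∷ xs) w

  end∈ : ∀ {u xs w} → IPath u xs w → w ∈ˡ u ∷ xs
  end∈ stop         = here refl
  end∈ (step _ _ p) = there (end∈ p)

  start∉tail : ∀ {u xs w} → IPath u xs w → u ∉ˡ xs
  start∉tail (step _ c _) u∈ = proj₁ (c u∈) refl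

  nontrivial : ∀ {u xs w} → IPath u xs w → u ≢ w → 1 ≤ length xs
  nontrivial stop         u≢w = contradiction refl u≢w
  nontrivial (step _ _ _) _   = s≤s z≤n

  edge : ∀ {u v} → Adj G u v → IPath u [ v ] v
  edge {u} a = step a (λ { (here refl) → (λ { refl → adj-irrefl G u a }) , λ _ → refl }) stop

  -- The junction `s` is exempt from the last hypothesis because its contacts with `ys` are governed
  -- by the second path; all other contacts between the pieces would be chords or repetitions.
  concat : ∀ {u xs s ys w} → IPath u xs s → IPath s ys w →
           (∀ {x y} → x ∈ˡ u ∷ xs → x ≢ s → y ∈ˡ ys → ¬ Touch x y) →
           IPath u (xs ++ ys) w
  concat stop q _ = q
  concat {u} {v ∷ xs} {ys = ys} (step a c p) q h = step a c′ (concat p q (h ∘ there))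
    where
    c′ : ∀ {x} → x ∈ˡ v ∷ xs ++ ys → u ≢ x × (Adj G u x → x ≡ v)
    c′ x∈ with ∈-++⁻ (v ∷ xs) x∈
    ... | inj₁ x∈xs = c x∈xs
    ... | inj₂ x∈ys = t ∘ inj₁ , ⊥-elim ∘ t ∘ inj₂
      where t = h (here refl) (proj₁ (c (end∈ p))) x∈ys

  abstract
    reversal : ∀ {u xs w} → IPath u xs w →
               ∃[ ys ] (IPath w ys u × (∀ {x} → x ∈ˡ w ∷ ys → x ∈ˡ u ∷ xs) ×
                        (∀ {x} → x ∈ˡ u ∷ xs → x ∈ˡ w ∷ ys) × length ys ≡ length xs)
    reversal stop = [] , stop , (λ x∈ → x∈) , (λ x∈ → x∈) , refl
    reversal {u} {v ∷ xs} {w} (step a c p) with reversal p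
    ... | ys , q , sub , sup , eq =
      ys ++ [ u ] , concat q (edge (adj-sym G a)) apart , sub′ , sup′ ,
      trans (length-++ ys) (trans (+-comm (length ys) 1) (cong suc eq))
      where
      apart : ∀ {x y} → x ∈ˡ w ∷ ys → x ≢ v → y ∈ˡ [ u ] → ¬ Touch x y
      apart x∈ x≢v (here refl) (inj₁ refl) = proj₁ (c (sub x∈)) refl
      apart x∈ x≢v (here refl) (inj₂ adj)  = x≢v (proj₂ (c (sub x∈)) (adj-sym G adj))
      sub′ : ∀ {x} → x ∈ˡ w ∷ ys ++ [ u ] → x ∈ˡ u ∷ v ∷ xs
      sub′ x∈ with ∈-++⁻ (w ∷ ys) x∈
      ... | inj₁ x∈ys       = there (sub x∈ys)
      ... | inj₂ (here refl) = here refl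
      sup′ : ∀ {x} → x ∈ˡ u ∷ v ∷ xs → x ∈ˡ w ∷ ys ++ [ u ]
      sup′ (here refl) = ∈-++⁺ʳ (w ∷ ys) (here refl)
      sup′ (there x∈)  = ∈-++⁺ˡ (sup x∈)

  Walk : Pred (Vertex G) 0ℓ → Rel (Vertex G) 0ℓ
  Walk P = Star (λ x y → P x × P y × Adj G x y)

  suffix : ∀ {u v xs w} → IPath v xs w → u ∈ˡ v ∷ xs →
           ∃[ ys ] (IPath u ys w × (∀ {x} → x ∈ˡ u ∷ ys → x ∈ˡ v ∷ xs))
  suffix p            (here refl) = _ , p , λ x∈ → x∈
  suffix (step _ _ p) (there u∈)  with suffix p u∈
  ... | ys , q , sub = ys , q , there ∘ sub

  -- Attach `u` at the last of its neighbours on the path and drop everything before that vertex; no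
  -- chord at `u` can then remain.
  extend : ∀ {u v xs w} → IPath v xs w → Any (Adj G u) (v ∷ xs) → u ∉ˡ v ∷ xs →
           ∃[ ys ] (IPath u ys w × (∀ {x} → x ∈ˡ u ∷ ys → x ∈ˡ u ∷ v ∷ xs))
  extend stop (here a) u∉ = _ , edge a , λ x∈ → x∈
  extend {u} {v} {xs} p@(step _ _ p′) a u∉ with any? (adj? G u) xs
  ... | yes b with extend p′ b (u∉ ∘ there)
  ...   | ys , q , sub = ys , q , λ x∈ → weaken (sub x∈)
    where
    weaken : ∀ {x} → x ∈ˡ u ∷ xs → x ∈ˡ u ∷ v ∷ xs
    weaken (here e)   = here e
    weaken (there x∈) = there (there x∈)
  extend {u} {v} {xs} p (here a) u∉ | no ¬b = _ , step a c p , λ x∈ → x∈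
    where
    c : ∀ {x} → x ∈ˡ v ∷ xs → u ≢ x × (Adj G u x → x ≡ v)
    c x∈ = (λ { refl → u∉ x∈ }) , only x∈
      where
      any-of : ∀ {x ys} → x ∈ˡ ys → Adj G u x → Any (Adj G u) ys
      any-of (here refl) b = here b
      any-of (there x∈)  b = there (any-of x∈ b)
      only : ∀ {x} → x ∈ˡ v ∷ xs → Adj G u x → x ≡ v
      only (here e)   _ = e
      only (there x∈) b = contradiction (any-of x∈ b) ¬b
  extend p (there a) u∉ | no ¬b = contradiction a ¬b

  abstract
    -- Built from the far end of the walk: a new first vertex either lies on the path found so far,
    -- and a suffix is taken, or is attached by `extend`. The hypothesis on `u` covers the empty
    -- walk, whose vertex satisfies no recorded condition.
    walk⇒path : ∀ {P u w} → Walk P u w → P u →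
                ∃[ xs ] (IPath u xs w × (∀ {x} → x ∈ˡ u ∷ xs → P x))
    walk⇒path ε Pu = [] , stop , λ { (here refl) → Pu }
    walk⇒path {u = u} (_◅_ {j = v} (_ , Pv , a) s) Pu with walk⇒path s Pv
    ... | xs , p , all with any? (u ≟ᶠ_) (v ∷ xs)
    ...   | yes u∈ with suffix p u∈
    ...     | ys , q , sub = ys , q , all ∘ sub
    walk⇒path {P} {u} (_◅_ {j = v} (_ , Pv , a) s) Pu | xs , p , all | no u∉ with extend p (here a) u∉
    ... | ys , q , sub = ys , q , λ x∈ → all′ (sub x∈)
      where
      all′ : ∀ {x} → x ∈ˡ u ∷ v ∷ xs → P x
      all′ (here refl) = Pu
      all′ (there x∈)  = all x∈

  lookup-injective : ∀ {u xs w} → IPath u xs w → Injective _≡_ _≡_ (lookup (u ∷ xs))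
  lookup-injective p            {zero}  {zero}  _ = refl
  lookup-injective (step _ c _) {zero}  {suc j} e = contradiction e (proj₁ (c (∈-lookup j)))
  lookup-injective (step _ c _) {suc i} {zero}  e = contradiction (sym e) (proj₁ (c (∈-lookup i)))
  lookup-injective (step _ _ p) {suc i} {suc j} e = cong suc (lookup-injective p e)

  lookup-next : ∀ {u xs w} → IPath u xs w → ∀ i j → suc (toℕ i) ≡ toℕ j →
                Adj G (lookup (u ∷ xs) i) (lookup (u ∷ xs) j)
  lookup-next (step a _ _) zero    (suc zero) _ = a
  lookup-next (step _ _ p) (suc i) (suc j)    e = lookup-next p i j (suc-injective e)

  lookup-adj : ∀ {u xs w} → IPath u xs w → ∀ i j →
               Adj G (lookup (u ∷ xs) i) (lookup (u ∷ xs) j) →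
               Adj (pathGraph (suc (length xs))) i j
  lookup-adj p zero zero a = contradiction a (adj-irrefl G _)
  lookup-adj (step _ c p) zero (suc j) a =
    inj₁ (cong (suc ∘ toℕ) (lookup-injective p {zero} {j} (sym (proj₂ (c (∈-lookup j)) a))))
  lookup-adj (step _ c p) (suc i) zero a =
    inj₂ (cong (suc ∘ toℕ)
               (lookup-injective p {zero} {i} (sym (proj₂ (c (∈-lookup i)) (adj-sym G a)))))
  lookup-adj (step _ _ p) (suc i) (suc j) a with lookup-adj p i j a
  ... | inj₁ e = inj₁ (cong suc e)
  ... | inj₂ e = inj₂ (cong suc e)

  lookup-last : ∀ {u xs w} → IPath u xs w → lookup (u ∷ xs) (fromℕ (length xs)) ≡ w
  lookup-last stop         = refl
  lookup-last (step _ _ p) = lookup-last p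

  toInduced : ∀ {u xs w} → IPath u xs w → InducedPath G u w
  toInduced {u} {xs} p = record
    { edgeCount = length xs
    ; embedding = record
      { to        = lookup (u ∷ xs)
      ; injective = lookup-injective p
      ; adj⇔adj   = λ i j → mk⇔
          [ lookup-next p i j , adj-sym G ∘ lookup-next p j i ]′
          (lookup-adj p i j)
      }
    ; start     = refl
    ; end       = lookup-last p
    }

  V⇒∈ : ∀ {u xs w x} (p : IPath u xs w) → V (toInduced p) x → x ∈ˡ u ∷ xs
  V⇒∈ p (i , refl) = ∈-lookup i

  ∈⇒V : ∀ {u xs w x} (p : IPath u xs w) → x ∈ˡ u ∷ xs → V (toInduced p) x
  ∈⇒V p x∈ = index x∈ , sym (lookup-index x∈)

  -- The apex z closes an induced path to an induced cycle.
  hole : ∀ {x xs y z} → IPath x xs y → x ≢ y →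
         (∀ {t} → t ∈ˡ x ∷ xs → z ≢ t) → Adj G z x → Adj G z y →
         (∀ {t} → t ∈ˡ x ∷ xs → Adj G z t → t ≡ x ⊎ t ≡ y) →
         ∃[ m ] (length xs ≤ 3 + m × (cycleGraph m ⊑ G))
  hole stop x≢y _ _ _ _ = contradiction refl x≢y
  hole {x} {v ∷ xs} {y} {z} p@(step _ _ _) x≢y z∉ zx zy only =
    -- The vertices of the cycle are `z`, `x`, `v` and those of `xs`, so counted from the triangle
    -- its index is `length xs`.
    length xs , s≤3+ , record { to = to′ ; injective = inj ; adj⇔adj = λ i j → mk⇔ (fwd i j) (bwd i j) }
    where
    s≤3+ : suc (length xs) ≤ 3 + length xs
    s≤3+ = m≤n+m (suc (length xs)) 2
    C = cycleGraph (length xs)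
    to′ : Vertex C → Vertex G
    to′ = lookup (z ∷ x ∷ v ∷ xs)
    inj : Injective _≡_ _≡_ to′
    inj {zero}  {zero}  _ = refl
    inj {zero}  {suc j} e = contradiction e (z∉ (∈-lookup j))
    inj {suc i} {zero}  e = contradiction (sym e) (z∉ (∈-lookup i))
    inj {suc i} {suc j} e = cong suc (lookup-injective p e)
    last : ∀ j → suc (toℕ j) ≡ 2 + length xs → lookup (x ∷ v ∷ xs) j ≡ y
    last j e = trans
      (cong (lookup (x ∷ v ∷ xs)) (toℕ-injective (trans (suc-injective e) (sym (toℕ-fromℕ _)))))
      (lookup-last p)
    next : ∀ i j → (suc (toℕ i) ≡ toℕ j ⊎ (suc (toℕ i) ≡ 3 + length xs × toℕ j ≡ 0)) → Adj G (to′ i) (to′ j)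
    next zero    (suc zero) (inj₁ _)       = zx
    next (suc i) (suc j)    (inj₁ e)       = lookup-next p i j (suc-injective e)
    next zero    zero       (inj₂ (() , _))
    next (suc i) zero       (inj₂ (e , _)) =
      adj-sym G (subst (Adj G z) (sym (last i (suc-injective e))) zy)
    fwd : ∀ i j → Adj C i j → Adj G (to′ i) (to′ j)
    fwd i j (inj₁ n) = next i j n
    fwd i j (inj₂ n) = adj-sym G (next j i n)
    -- The neighbours of `z` sit at positions 1 and 2 + `length xs`; the second of these edges is
    -- the one that wraps around.
    zcase : ∀ j → Adj G z (lookup (x ∷ v ∷ xs) j) → Adj C zero (suc j)
    zcase j a with only (∈-lookup j) a
    ... | inj₁ e = inj₁ (inj₁ (cong (suc ∘ toℕ) (sym (lookup-injective p {j} {zero} e))))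
    ... | inj₂ e = inj₂ (inj₂ (cong (λ t → suc (suc t)) lst , refl))
      where
      lst : toℕ j ≡ suc (length xs)
      lst = trans (cong toℕ (lookup-injective p (trans e (sym (lookup-last p))))) (toℕ-fromℕ _)
    bwd : ∀ i j → Adj G (to′ i) (to′ j) → Adj C i j
    bwd zero    zero    a = contradiction a (adj-irrefl G z)
    bwd zero    (suc j) a = zcase j a
    bwd (suc i) zero    a = swap (zcase i (adj-sym G a))
    bwd (suc i) (suc j) a with lookup-adj p i j a
    ... | inj₁ e = inj₁ (inj₁ (cong suc e))
    ... | inj₂ e = inj₂ (inj₁ (cong suc e))

-- Thetas, prisms and pyramids

allPairs-lookup : ∀ {A : Set} {R : Rel A 0ℓ} → Symmetric R → ∀ {xs} → AllPairs R xs →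
                  ∀ {i j} → i ≢ j → R (lookup xs i) (lookup xs j)
allPairs-lookup sy (r ∷ rs) {zero}  {zero}  i≢j = contradiction refl i≢j
allPairs-lookup sy (r ∷ rs) {zero}  {suc j} i≢j = All.lookup r (∈-lookup j)
allPairs-lookup sy (r ∷ rs) {suc i} {zero}  i≢j = sy (All.lookup r (∈-lookup i))
allPairs-lookup sy (r ∷ rs) {suc i} {suc j} i≢j = allPairs-lookup sy rs (i≢j ∘ cong suc)

unique-lookup : ∀ {A : Set} {xs : List A} → AllPairs _≢_ xs → Injective _≡_ _≡_ (lookup xs)
unique-lookup u {i} {j} e with i ≟ᶠ j
... | yes i≡j = i≡j
... | no  i≢j = contradiction e (allPairs-lookup (λ x≢y → x≢y ∘ sym) u i≢j)

-- The shape of one side of a configuration: a theta has two stars, a prism two cliques, a pyramid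
-- one of each.
data Kind : Set where
  star clique : Kind

-- The paths of a theta need three edges, of which the opposite half may
-- contribute only one.
startLong : Kind → ℕ
startLong star   = 2
startLong clique = 1

module _ (G : Graph) where
  open Paths G

  private variable
    k ℓ ℓ′ : ℕ
    κ κ′ : Kind

  Joint : Kind → (Fin k → Vertex G) → Set
  Joint star   e = ∀ i j → e i ≡ e j
  Joint clique e = IsClique G e

  -- The contacts between paths i and j that this side permits. At a star the common vertex may
  -- touch anything on the other path; at a clique only the two ends may touch each other.
  AtEnd : Kind → (Fin k → Vertex G) → Fin k → Fin k → Vertex G → Vertex G → Set
  AtEnd star   e i j x y = x ≡ e i ⊎ y ≡ e j
  AtEnd clique e i j x y = x ≡ e i × y ≡ e j

  -- k legs ending at the s i whose other ends e i coincide (star) or form a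
  -- clique; nothing is said about adjacency between the s i.
  record Half (κ : Kind) (ℓ k : ℕ) (s : Fin k → Vertex G) (X : Pred (Vertex G) 0ℓ) : Set where
    field
      e      : Fin k → Vertex G
      tail   : Fin k → List (Vertex G)
      path   : ∀ i → IPath (e i) (tail i) (s i)
      joint  : Joint κ e
      long   : ∀ i → ℓ ≤ length (tail i)
      inside : ∀ i {x} → x ∈ˡ e i ∷ tail i → x ≡ s i ⊎ X x
      cross  : ∀ {i j x y} → i ≢ j → x ∈ˡ e i ∷ tail i → y ∈ˡ e j ∷ tail j → Touch x y →
               AtEnd κ e i j x y ⊎ (x ≡ s i × y ≡ s j)

  -- Common form of the three forbidden configurations inside a larger graph. Since `ℓ` counts
  -- edges, the minimal lengths 4, 2 and 3 of theta, prism and pyramid become 3, 1 and 2.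
  record Full (κ κ′ : Kind) (ℓ k : ℕ) : Set where
    field
      e f    : Fin k → Vertex G
      tail   : Fin k → List (Vertex G)
      path   : ∀ i → IPath (e i) (tail i) (f i)
      jointₑ : Joint κ e
      joint  : Joint κ′ f
      long   : ∀ i → ℓ ≤ length (tail i)
      cross  : ∀ {i j x y} → i ≢ j → x ∈ˡ e i ∷ tail i → y ∈ˡ e j ∷ tail j → Touch x y →
               AtEnd κ e i j x y ⊎ AtEnd κ′ f i j x y

  -- Legs without edges: ends that already form a clique close off the other half by themselves.
  clique-half : ∀ {s : Fin k → Vertex G} → IsClique G s → Half clique 0 k s (λ _ → ⊥)
  clique-half {s = s} cl = record
    { e = s ; tail = λ _ → [] ; path = λ _ → stop ; joint = cl ; long = λ _ → z≤n
    ; inside = λ { i (here x≡) → inj₁ x≡ }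
    ; cross  = λ { _ (here x≡) (here y≡) _ → inj₁ (x≡ , y≡) } }

  -- Each leg of `P` is followed by the reversed leg of `Q`. Contacts between `X` and `Y` are
  -- excluded, and a contact involving some `s i` lies within one half. Only contacts between `s i`
  -- and `s j` remain, and `ends` attributes them to the far side of `Q`.
  glue : ∀ {s : Fin k → Vertex G} {X Y} (P : Half κ ℓ k s X) (Q : Half κ′ ℓ′ k s Y) →
         (∀ {x y} → X x → Y y → ¬ Touch x y) →
         (∀ {i j} → i ≢ j → Touch (s i) (s j) → AtEnd κ′ (Half.e Q) i j (s i) (s j)) →
         Full κ κ′ (ℓ + ℓ′) k
  glue {k = k} {κ = κ} {ℓ = ℓ} {κ′ = κ′} {ℓ′ = ℓ′} {s} {X} {Y} P Q anti ends = record
    { e = P.e ; f = Q.e ; tail = λ i → P.tail i ++ ys i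
    ; path   = λ i → concat (P.path i) (back i) (apart i)
    ; jointₑ = P.joint ; joint = Q.joint ; long = lng ; cross = crs }
    where
    module P = Half P
    module Q = Half Q
    rev = λ i → reversal (Q.path i)
    ys = λ i → proj₁ (rev i)
    back = λ i → proj₁ (proj₂ (rev i))
    sub : ∀ i {x} → x ∈ˡ s i ∷ ys i → x ∈ˡ Q.e i ∷ Q.tail i
    sub i = proj₁ (proj₂ (proj₂ (rev i)))
    apart : ∀ i {x y} → x ∈ˡ P.e i ∷ P.tail i → x ≢ s i → y ∈ˡ ys i → ¬ Touch x y
    apart i x∈ x≢ y∈ t with P.inside i x∈ | Q.inside i (sub i (there y∈))
    ... | inj₁ x≡ | _         = x≢ x≡
    ... | inj₂ Xx | inj₁ refl = start∉tail (back i) y∈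
    ... | inj₂ Xx | inj₂ Yy   = anti Xx Yy t
    lng : ∀ i → ℓ + ℓ′ ≤ length (P.tail i ++ ys i)
    lng i = ≤-trans (+-mono-≤ (P.long i) (≤-trans (Q.long i)
                      (≤-reflexive (sym (proj₂ (proj₂ (proj₂ (proj₂ (rev i)))))))))
                    (≤-reflexive (sym (length-++ (P.tail i))))
    split : ∀ i {x} → x ∈ˡ P.e i ∷ P.tail i ++ ys i → x ∈ˡ P.e i ∷ P.tail i ⊎ x ∈ˡ Q.e i ∷ Q.tail i
    split i x∈ with ∈-++⁻ (P.e i ∷ P.tail i) x∈
    ... | inj₁ x∈P = inj₁ x∈P
    ... | inj₂ x∈Q = inj₂ (sub i (there x∈Q))
    module _ {i j : Fin k} {x y : Vertex G} (i≢j : i ≢ j) (t : Touch x y) where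
      tidy : ∀ {A : Set} → A ⊎ (x ≡ s i × y ≡ s j) → A ⊎ AtEnd κ′ Q.e i j x y
      tidy (inj₁ a)             = inj₁ a
      tidy (inj₂ (refl , refl)) = inj₂ (ends i≢j t)
      crossQ : x ∈ˡ Q.e i ∷ Q.tail i → y ∈ˡ Q.e j ∷ Q.tail j → AtEnd κ P.e i j x y ⊎ AtEnd κ′ Q.e i j x y
      crossQ x∈ y∈ with tidy (Q.cross i≢j x∈ y∈ t)
      ... | inj₁ a = inj₂ a
      ... | inj₂ a = inj₂ a
    crs : ∀ {i j x y} → i ≢ j → x ∈ˡ P.e i ∷ P.tail i ++ ys i → y ∈ˡ P.e j ∷ P.tail j ++ ys j →
          Touch x y → AtEnd κ P.e i j x y ⊎ AtEnd κ′ Q.e i j x y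
    crs {i} {j} i≢j x∈ y∈ t with split i x∈ | split j y∈
    ... | inj₁ x∈P | inj₁ y∈P = tidy i≢j t (P.cross i≢j x∈P y∈P t)
    ... | inj₂ x∈Q | inj₂ y∈Q = crossQ i≢j t x∈Q y∈Q
    ... | inj₁ x∈P | inj₂ y∈Q with P.inside i x∈P | Q.inside j y∈Q
    ...   | inj₁ refl | _         = crossQ i≢j t (end∈ (Q.path i)) y∈Q
    ...   | inj₂ _    | inj₁ refl = tidy i≢j t (P.cross i≢j x∈P (end∈ (P.path j)) t)
    ...   | inj₂ Xx   | inj₂ Yy   = contradiction t (anti Xx Yy)
    crs {i} {j} i≢j x∈ y∈ t | inj₂ x∈Q | inj₁ y∈P with Q.inside i x∈Q | P.inside j y∈P
    ...   | _         | inj₁ refl = crossQ i≢j t x∈Q (end∈ (Q.path j))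
    ...   | inj₁ refl | inj₂ _    = tidy i≢j t (P.cross i≢j (end∈ (P.path i)) y∈P t)
    ...   | inj₂ Yx   | inj₂ Xy   = contradiction (touch-sym t) (anti Xy Yx)

  end∈tail : ∀ {u xs w} → 1 ≤ length xs → IPath u xs w → w ∈ˡ xs
  end∈tail 1≤ (step _ _ p) = end∈ p

  ends-distinct : ∀ {u xs w} → 1 ≤ length xs → IPath u xs w → u ≢ w
  ends-distinct 1≤ p refl = start∉tail p (end∈tail 1≤ p)

  ends-nonadjacent : ∀ {u xs w} → 2 ≤ length xs → IPath u xs w → ¬ Adj G u w
  ends-nonadjacent (s≤s 1≤) (step _ c p) a = ends-distinct 1≤ p (sym (proj₂ (c (end∈ p)) a))

-- Restriction to the subgraph induced by the paths

Covers : ∀ {H κ κ′ ℓ k} → Full H κ κ′ ℓ k → Set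
Covers {H} F = ∀ (v : Vertex H) → ∃[ i ] v ∈ˡ Full.e F i ∷ Full.tail F i

module Restrict {G : Graph} {κ κ′ : Kind} {ℓ k : ℕ} (F : Full G κ κ′ ℓ k) where
  open Full F
  open Paths G using (IPath; stop; step; end∈)

  U : Pred (Vertex G) 0ℓ
  U x = ∃[ i ] x ∈ˡ e i ∷ tail i

  U? : U.Decidable U
  U? x = anyᶠ? (λ i → any? (x ≟ᶠ_) (e i ∷ tail i))

  us : List (Vertex G)
  us = filter U? (allFin (order G))

  H : Graph
  H = record
    { order      = length us
    ; Adj        = λ i j → Adj G (lookup us i) (lookup us j)
    ; adj?       = λ i j → adj? G (lookup us i) (lookup us j)
    ; adj-sym    = adj-sym G
    ; adj-irrefl = λ i → adj-irrefl G (lookup us i)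
    }

  open Paths H using () renaming (IPath to IPathᴴ; stop to stopᴴ; step to stepᴴ)

  ι : Vertex H → Vertex G
  ι = lookup us

  ι-injective : Injective _≡_ _≡_ ι
  ι-injective = unique-lookup (filter⁺ U? (allFin⁺ (order G)))

  ι-surjective : ∀ {x} → U x → ∃[ h ] x ≡ ι h
  ι-surjective {x} Ux = index x∈ , lookup-index x∈
    where x∈ = ∈-filter⁺ U? (∈-allFin x) Ux

  H⊑G : H ⊑ G
  H⊑G = record { to = ι ; injective = ι-injective ; adj⇔adj = λ _ _ → mk⇔ (λ a → a) (λ a → a) }

  -- Adjacency in `H` is adjacency of images and `ι` is injective, so choosing preimages vertex by
  -- vertex creates neither chords nor repetitions.
  pull : ∀ h h′ {xs} → IPath (ι h) xs (ι h′) → (∀ {x} → x ∈ˡ xs → U x) →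
         ∃[ zs ] (IPathᴴ h zs h′ × map ι zs ≡ xs)
  pull h h′ p all = go p h refl refl all
    where
    go : ∀ {u xs w} → IPath u xs w → ∀ h → u ≡ ι h → w ≡ ι h′ → (∀ {x} → x ∈ˡ xs → U x) →
         ∃[ zs ] (IPathᴴ h zs h′ × map ι zs ≡ xs)
    go stop h u≡ w≡ all with ι-injective (trans (sym u≡) w≡)
    ... | refl = [] , stopᴴ , refl
    go (step a c p) h refl w≡ all with ι-surjective (all (here refl))
    ... | h₁ , refl with go p h₁ refl w≡ (all ∘ there)
    ...   | zs , q , refl = h₁ ∷ zs , stepᴴ a c′ q , refl
      where
      c′ : ∀ {z} → z ∈ˡ h₁ ∷ zs → h ≢ z × (Adj H h z → z ≡ h₁)
      c′ z∈ with c (∈-map⁺ ι z∈)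
      ... | ne , only = ne ∘ cong ι , ι-injective ∘ only

  e∈ : ∀ i → ∃[ h ] e i ≡ ι h
  e∈ i = ι-surjective (i , here refl)

  f∈ : ∀ i → ∃[ h ] f i ≡ ι h
  f∈ i = ι-surjective (i , end∈ (path i))

  eᴴ fᴴ : Fin k → Vertex H
  eᴴ i = proj₁ (e∈ i)
  fᴴ i = proj₁ (f∈ i)

  pulled : ∀ i → ∃[ zs ] (IPathᴴ (eᴴ i) zs (fᴴ i) × map ι zs ≡ tail i)
  pulled i = pull (eᴴ i) (fᴴ i) (subst₂ (λ u w → IPath u (tail i) w) (proj₂ (e∈ i)) (proj₂ (f∈ i)) (path i))
                  (λ x∈ → i , there x∈)

  tailᴴ : Fin k → List (Vertex H)
  tailᴴ i = proj₁ (pulled i)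

  map-tail : ∀ i → map ι (eᴴ i ∷ tailᴴ i) ≡ e i ∷ tail i
  map-tail i = cong₂ _∷_ (sym (proj₂ (e∈ i))) (proj₂ (proj₂ (pulled i)))

  ∈⇒ : ∀ i {z} → z ∈ˡ eᴴ i ∷ tailᴴ i → ι z ∈ˡ e i ∷ tail i
  ∈⇒ i {z} z∈ = subst (ι z ∈ˡ_) (map-tail i) (∈-map⁺ ι z∈)

  ∈⇐ : ∀ i {z} → ι z ∈ˡ e i ∷ tail i → z ∈ˡ eᴴ i ∷ tailᴴ i
  ∈⇐ i {z} z∈ with ∈-map⁻ ι (subst (ι z ∈ˡ_) (sym (map-tail i)) z∈)
  ... | z′ , z′∈ , eq = subst (_∈ˡ _) (sym (ι-injective eq)) z′∈

  jointᴴ : ∀ κ {g gᴴ} → (∀ i → g i ≡ ι (gᴴ i)) → Joint G {k} κ g → Joint H κ gᴴ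
  jointᴴ star   eq J i j       = ι-injective (trans (sym (eq i)) (trans (J i j) (eq j)))
  jointᴴ clique eq J {i} {j} n = subst₂ (Adj G) (eq i) (eq j) (J n)

  atEndᴴ : ∀ κ {g gᴴ} → (∀ i → g i ≡ ι (gᴴ i)) → ∀ {i j x y} →
           AtEnd G {k} κ g i j (ι x) (ι y) → AtEnd H κ gᴴ i j x y
  atEndᴴ star   eq (inj₁ p) = inj₁ (ι-injective (trans p (eq _)))
  atEndᴴ star   eq (inj₂ p) = inj₂ (ι-injective (trans p (eq _)))
  atEndᴴ clique eq (p , q)  = ι-injective (trans p (eq _)) , ι-injective (trans q (eq _))

  Fᴴ : Full H κ κ′ ℓ k
  Fᴴ = record
    { e = eᴴ ; f = fᴴ ; tail = tailᴴ
    ; path   = λ i → proj₁ (proj₂ (pulled i))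
    ; jointₑ = jointᴴ κ (λ i → proj₂ (e∈ i)) jointₑ
    ; joint  = jointᴴ κ′ (λ i → proj₂ (f∈ i)) joint
    ; long   = λ i → ≤-trans (long i) (≤-reflexive
                 (trans (cong length (sym (proj₂ (proj₂ (pulled i))))) (length-map ι (tailᴴ i))))
    ; cross  = crs
    }
    where
    crs : ∀ {i j x y} → i ≢ j → x ∈ˡ eᴴ i ∷ tailᴴ i → y ∈ˡ eᴴ j ∷ tailᴴ j → Paths.Touch H x y →
          AtEnd H κ eᴴ i j x y ⊎ AtEnd H κ′ fᴴ i j x y
    crs {i} {j} i≢j x∈ y∈ t with cross i≢j (∈⇒ i x∈) (∈⇒ j y∈) (touch t)
      where
      touch : ∀ {x y} → Paths.Touch H x y → Paths.Touch G (ι x) (ι y)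
      touch (inj₁ e) = inj₁ (cong ι e)
      touch (inj₂ a) = inj₂ a
    ... | inj₁ a = inj₁ (atEndᴴ κ (λ i → proj₂ (e∈ i)) a)
    ... | inj₂ a = inj₂ (atEndᴴ κ′ (λ i → proj₂ (f∈ i)) a)

  covers : Covers Fᴴ
  covers v with proj₂ (∈-filter⁻ U? {xs = allFin (order G)} (∈-lookup v))
  ... | i , x∈ = i , ∈⇐ i x∈

-- Recognising thetas, prisms and pyramids

module _ {H : Graph} where
  open Paths H

  -- The common ends are read off from path `zero`, so at least one path must exist.
  full⇒theta : ∀ {k} (F : Full H star star 3 (suc k)) → Covers F → IsTheta (suc k) H
  full⇒theta {k} F covers = record
    { a         = a
    ; b         = b
    ; a≢b       = ends-distinct H (≤-trans (s≤s z≤n) (long zero)) (path zero)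
    ; path      = λ i → toInduced (path′ i)
    ; length≥4  = λ i → s≤s (long i)
    ; interiors = λ i≢j → (λ { ((Vi , ≢a , ≢b) , (Vj , _)) → apart i≢j Vi ≢a ≢b Vj ≢a ≢b (inj₁ refl) })
                        , (λ { (Vi , x≢a , x≢b) (Vj , y≢a , y≢b) → apart i≢j Vi x≢a x≢b Vj y≢a y≢b ∘ inj₂ })
    ; covers    = λ v → inj₂ (inj₂ (covered v))
    ; edges     = edges′
    }
    where
    open Full F
    a = e zero
    b = f zero
    path′ : ∀ i → IPath a (tail i) b
    path′ i = subst₂ (λ u w → IPath u (tail i) w) (jointₑ i zero) (joint i zero) (path i)
    V⇒ : ∀ i {x} → V (toInduced (path′ i)) x → x ∈ˡ e i ∷ tail i
    V⇒ i {x} v = subst (λ u → x ∈ˡ u ∷ tail i) (jointₑ zero i) (V⇒∈ (path′ i) v)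
    ⇒V : ∀ i {x} → x ∈ˡ e i ∷ tail i → V (toInduced (path′ i)) x
    ⇒V i {x} v = ∈⇒V (path′ i) (subst (λ u → x ∈ˡ u ∷ tail i) (jointₑ i zero) v)
    covered : ∀ v → ∃[ i ] V (toInduced (path′ i)) v
    covered v with covers v
    ... | i , v∈ = i , ⇒V i v∈
    apart : ∀ {i j x y} → i ≢ j → V (toInduced (path′ i)) x → x ≢ a → x ≢ b →
            V (toInduced (path′ j)) y → y ≢ a → y ≢ b → ¬ Touch x y
    apart {i} {j} i≢j Vx x≢a x≢b Vy y≢a y≢b t with cross i≢j (V⇒ i Vx) (V⇒ j Vy) t
    ... | inj₁ (inj₁ p) = x≢a (trans p (jointₑ i zero))
    ... | inj₁ (inj₂ p) = y≢a (trans p (jointₑ j zero))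
    ... | inj₂ (inj₁ p) = x≢b (trans p (joint i zero))
    ... | inj₂ (inj₂ p) = y≢b (trans p (joint j zero))
    e∈ : ∀ i j {x} → x ≡ e i → V (toInduced (path′ j)) x
    e∈ i j refl = ⇒V j (here (jointₑ i j))
    f∈ : ∀ i j {x} → x ≡ f i → V (toInduced (path′ j)) x
    f∈ i j refl = ⇒V j (subst (_∈ˡ e j ∷ tail j) (joint j i) (end∈ (path j)))
    -- An edge between different paths contains `a` or `b`, and these lie on every path.
    edges′ : ∀ {u v} → Adj H u v → ∃[ i ] (V (toInduced (path′ i)) u × V (toInduced (path′ i)) v)
    edges′ {u} {v} adj with covers u | covers v
    ... | i , u∈ | j , v∈ with i ≟ᶠ j
    ...   | yes refl = i , ⇒V i u∈ , ⇒V i v∈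
    ...   | no i≢j with cross i≢j u∈ v∈ (inj₂ adj)
    ...     | inj₁ (inj₁ p) = j , e∈ i j p , ⇒V j v∈
    ...     | inj₁ (inj₂ p) = i , ⇒V i u∈ , e∈ j i p
    ...     | inj₂ (inj₁ p) = j , f∈ i j p , ⇒V j v∈
    ...     | inj₂ (inj₂ p) = i , ⇒V i u∈ , f∈ j i p

  full⇒prism : ∀ {k ℓ} → 1 ≤ ℓ → (F : Full H clique clique ℓ k) → Covers F → IsPrism k H
  full⇒prism {k} 1≤ℓ F covers = record
    { a        = e
    ; b        = f
    ; a-clique = jointₑ
    ; b-clique = joint
    ; a≢b      = a≢b
    ; path     = λ i → toInduced (path i)
    ; length≥2 = λ i → s≤s (long′ i)
    ; disjoint = λ { i≢j (Vi , Vj) → disjoint i≢j (V⇒∈ (path _) Vi) (V⇒∈ (path _) Vj) }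
    ; cross    = λ i≢j Vi Vj adj → cross i≢j (V⇒∈ (path _) Vi) (V⇒∈ (path _) Vj) (inj₂ adj)
    ; covers   = λ v → let i , v∈ = covers v in i , ∈⇒V (path i) v∈
    }
    where
    open Full F
    long′ : ∀ i → 1 ≤ length (tail i)
    long′ i = ≤-trans 1≤ℓ (long i)
    -- A shared vertex would be the end of both paths in one of the cliques, hence adjacent to
    -- itself.
    disjoint : ∀ {i j x} → i ≢ j → x ∈ˡ e i ∷ tail i → x ∈ˡ e j ∷ tail j → ⊥
    disjoint i≢j x∈ x∈′ with cross i≢j x∈ x∈′ (inj₁ refl)
    ... | inj₁ (p , q) = adj-irrefl H _ (subst (Adj H (e _)) (trans (sym q) p) (jointₑ i≢j))
    ... | inj₂ (p , q) = adj-irrefl H _ (subst (Adj H (f _)) (trans (sym q) p) (joint i≢j))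
    a≢b : ∀ i j → e i ≢ f j
    a≢b i j eq with i ≟ᶠ j
    ... | yes refl = ends-distinct H (long′ i) (path i) eq
    ... | no i≢j   = disjoint i≢j (here refl) (subst (_∈ˡ e j ∷ tail j) (sym eq) (end∈ (path j)))

  -- Two edges on each induced path keep the apex nonadjacent to the clique.
  full⇒pyramid : ∀ {k ℓ} → 2 ≤ ℓ → (F : Full H star clique ℓ (suc k)) → Covers F → IsPyramid (suc k) H
  full⇒pyramid {k} 2≤ℓ F covers = record
    { a              = a
    ; b              = f
    ; b-clique       = joint
    ; a-anticomplete = (λ { (refl , i , eq) → ends-distinct H (≤-trans (s≤s z≤n) (long′ i)) (path′ i) (sym eq) })
                     , (λ { refl (i , refl) → ends-nonadjacent H (long′ i) (path′ i) })
    ; path           = λ i → toInduced (path′ i)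
    ; length≥3       = λ i → s≤s (long′ i)
    ; disjoint       = λ i≢j Vi Vj → disjoint i≢j (V⇒ _ Vi) (V⇒ _ Vj)
    ; cross          = λ i≢j Vi u≢a Vj v≢a adj → cross′ i≢j (V⇒ _ Vi) u≢a (V⇒ _ Vj) v≢a (inj₂ adj)
    ; covers         = λ v → let i , v∈ = covers v in inj₂ (i , ⇒V i v∈)
    }
    where
    open Full F
    a = e zero
    long′ : ∀ i → 2 ≤ length (tail i)
    long′ i = ≤-trans 2≤ℓ (long i)
    path′ : ∀ i → IPath a (tail i) (f i)
    path′ i = subst (λ u → IPath u (tail i) (f i)) (jointₑ i zero) (path i)
    V⇒ : ∀ i {x} → V (toInduced (path′ i)) x → x ∈ˡ e i ∷ tail i
    V⇒ i {x} v = subst (λ u → x ∈ˡ u ∷ tail i) (jointₑ zero i) (V⇒∈ (path′ i) v)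
    ⇒V : ∀ i {x} → x ∈ˡ e i ∷ tail i → V (toInduced (path′ i)) x
    ⇒V i {x} v = ∈⇒V (path′ i) (subst (λ u → x ∈ˡ u ∷ tail i) (jointₑ i zero) v)
    cross′ : ∀ {i j x y} → i ≢ j → x ∈ˡ e i ∷ tail i → x ≢ a → y ∈ˡ e j ∷ tail j → y ≢ a →
             Touch x y → x ≡ f i × y ≡ f j
    cross′ {i} {j} i≢j x∈ x≢a y∈ y≢a t with cross i≢j x∈ y∈ t
    ... | inj₁ (inj₁ p) = contradiction (trans p (jointₑ i zero)) x≢a
    ... | inj₁ (inj₂ p) = contradiction (trans p (jointₑ j zero)) y≢a
    ... | inj₂ q        = q
    disjoint : ∀ {i j v} → i ≢ j → v ∈ˡ e i ∷ tail i → v ∈ˡ e j ∷ tail j → v ≡ a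
    disjoint {v = v} i≢j v∈ v∈′ with v ≟ᶠ a
    ... | yes v≡a = v≡a
    ... | no v≢a with cross′ i≢j v∈ v≢a v∈′ v≢a (inj₁ refl)
    ...   | p , q = ⊥-elim (adj-irrefl H _ (subst (Adj H (f _)) (trans (sym q) p) (joint i≢j)))

record Free (k : ℕ) (G : Graph) : Set₁ where
  field
    theta-free   : ThetaFree k G
    prism-free   : PrismFree k G
    pyramid-free : PyramidFree k G

module _ {G : Graph} {k : ℕ} (free : Free (suc k) G) where
  open Free free
  open Paths G

  ¬theta : ¬ Full G star star 3 (suc k)
  ¬theta F = theta-free H (full⇒theta Fᴴ covers) H⊑G
    where open Restrict F

  ¬prism : ∀ {ℓ} → 1 ≤ ℓ → ¬ Full G clique clique ℓ (suc k)
  ¬prism 1≤ℓ F = prism-free H (full⇒prism 1≤ℓ Fᴴ covers) H⊑G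
    where open Restrict F

  ¬pyramid : ∀ {ℓ} → 2 ≤ ℓ → ¬ Full G star clique ℓ (suc k)
  ¬pyramid 2≤ℓ F = pyramid-free H (full⇒pyramid 2≤ℓ Fᴴ covers) H⊑G
    where open Restrict F

-- Ramsey and pigeonhole

length-filters : ∀ {A : Set} {P : Pred A 0ℓ} (P? : U.Decidable P) xs →
                 length (filter P? xs) + length (filter (¬? ∘ P?) xs) ≡ length xs
length-filters P? [] = refl
length-filters P? (x ∷ xs) with P? x
... | yes _ = cong suc (length-filters P? xs)
... | no _  = trans (+-suc (length (filter P? xs)) _) (cong suc (length-filters P? xs))

+-split : ∀ {a b} c d → a + b ≤ c + d → a ≤ c ⊎ b ≤ d
+-split {a} {b} c d le with a ≤? c
... | yes a≤c = inj₁ a≤c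
... | no a≰c with b ≤? d
...   | yes b≤d = inj₂ b≤d
...   | no b≰d = contradiction le (<⇒≱ (+-mono-< (≰⇒> a≰c) (≰⇒> b≰d)))

-- An upper bound for the Ramsey numbers; the outer `suc` counts the pivot of the induction.
ram : ℕ → ℕ → ℕ
ram zero    b       = 0
ram (suc a) zero    = 0
ram (suc a) (suc b) = suc (ram a (suc b) + ram (suc a) b)

Homogeneous : ∀ {A : Set} → Rel A 0ℓ → ℕ → List A → Set
Homogeneous R a xs = ∃[ ys ] (length ys ≡ a × (∀ {y} → y ∈ˡ ys → y ∈ˡ xs) × AllPairs (λ x y → x ≢ y × R x y) ys)

-- The first element splits the rest into those related to it and those not, and one part is large
-- enough for the induction. The pivot joins the list found if that list has the colour of the part.
ramsey : ∀ {A : Set} {R : Rel A 0ℓ} → Decidable R → ∀ a b xs → Unique xs → ram a b ≤ length xs →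
         Homogeneous R a xs ⊎ Homogeneous (λ x y → ¬ R x y) b xs
ramsey R? zero    b       xs u le = inj₁ ([] , refl , (λ ()) , [])
ramsey R? (suc a) zero    xs u le = inj₂ ([] , refl , (λ ()) , [])
ramsey {A} {R} R? (suc a) (suc b) (x ∷ xs) (x∉ ∷ u) (s≤s le)
  with +-split (length (filter (R? x) xs)) (length (filter (¬? ∘ R? x) xs))
               (≤-trans le (≤-reflexive (sym (length-filters (R? x) xs))))
... | inj₁ le₁ with ramsey R? a (suc b) (filter (R? x) xs) (filter⁺ (R? x) u) le₁
...   | inj₁ (ys , len , sub , ap) = inj₁
  ( x ∷ ys , cong suc len
  , (λ { (here e) → here e ; (there y∈) → there (proj₁ (∈-filter⁻ (R? x) {xs = xs} (sub y∈))) })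
  , All.tabulate (λ y∈ → let y∈xs , r = ∈-filter⁻ (R? x) {xs = xs} (sub y∈) in All.lookup x∉ y∈xs , r) ∷ ap )
...   | inj₂ (ys , len , sub , ap) = inj₂
  ( ys , len , (λ y∈ → there (proj₁ (∈-filter⁻ (R? x) {xs = xs} (sub y∈)))) , ap )
ramsey {A} {R} R? (suc a) (suc b) (x ∷ xs) (x∉ ∷ u) (s≤s le)
    | inj₂ le₂ with ramsey R? (suc a) b (filter (¬? ∘ R? x) xs) (filter⁺ (¬? ∘ R? x) u) le₂
...   | inj₁ (ys , len , sub , ap) = inj₁
  ( ys , len , (λ y∈ → there (proj₁ (∈-filter⁻ (¬? ∘ R? x) {xs = xs} (sub y∈)))) , ap )
...   | inj₂ (ys , len , sub , ap) = inj₂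
  ( x ∷ ys , cong suc len
  , (λ { (here e) → here e ; (there y∈) → there (proj₁ (∈-filter⁻ (¬? ∘ R? x) {xs = xs} (sub y∈))) })
  , All.tabulate (λ y∈ → let y∈xs , r = ∈-filter⁻ (¬? ∘ R? x) {xs = xs} (sub y∈) in All.lookup x∉ y∈xs , r) ∷ ap )

Selection : ∀ {n} → Rel (Fin n) 0ℓ → ℕ → Set
Selection {n} R a = Σ[ φ ∈ (Fin a → Fin n) ] (∀ {i j} → i ≢ j → φ i ≢ φ j × R (φ i) (φ j))

ramsey-fin : ∀ {n} {R : Rel (Fin n) 0ℓ} → Decidable R → Symmetric R → ∀ a b → ram a b ≤ n →
             Selection R a ⊎ Selection (λ x y → ¬ R x y) b
ramsey-fin {n} R? sy a b le
  with ramsey R? a b (allFin n) (allFin⁺ n) (≤-trans le (≤-reflexive (sym (length-tabulate (λ x → x)))))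
... | inj₁ (ys , refl , _ , ap) = inj₁ (lookup ys , allPairs-lookup (λ (n , r) → n ∘ sym , sy r) ap)
... | inj₂ (ys , refl , _ , ap) = inj₂ (lookup ys , allPairs-lookup (λ (n , r) → n ∘ sym , r ∘ sy) ap)

initial : ∀ {A : Set} {xs : List A} {k} → Unique xs → k ≤ length xs →
          Σ[ φ ∈ (Fin k → A) ] ((∀ i → φ i ∈ˡ xs) × (∀ {i j} → i ≢ j → φ i ≢ φ j))
initial {xs = xs} u le = (λ i → lookup xs (inject≤ i le)) , (λ i → ∈-lookup (inject≤ i le)) ,
                         λ i≢j e → i≢j (inject≤-injective le le _ _ (unique-lookup u e))

-- If `y` serves fewer than `k` of the indices, discarding these leaves more than `length ys * k` of
-- them for the remaining `ys`.
pigeonhole-list : ∀ {A B : Set} {Q : A → B → Set} → (∀ y i → Dec (Q y i)) → ∀ ys k is → Unique is →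
                  (∀ {i} → i ∈ˡ is → Any (λ y → Q y i) ys) → length ys * k < length is →
                  ∃[ y ] Σ[ φ ∈ (Fin k → B) ] (y ∈ˡ ys × (∀ j → Q y (φ j)) × (∀ {i j} → i ≢ j → φ i ≢ φ j))
pigeonhole-list Q? [] k (i ∷ is) u h lt with h (here refl)
... | ()
pigeonhole-list {Q = Q} Q? (y ∷ ys) k is u h lt with k ≤? length (filter (Q? y) is)
... | yes le = let φ , φ∈ , inj = initial (filter⁺ (Q? y) u) le in
               y , φ , here refl , (λ j → proj₂ (∈-filter⁻ (Q? y) {xs = is} (φ∈ j))) , inj
... | no ¬le with pigeonhole-list Q? ys k (filter (¬? ∘ Q? y) is) (filter⁺ (¬? ∘ Q? y) u) h′ lt′
  where
  h′ : ∀ {i} → i ∈ˡ filter (¬? ∘ Q? y) is → Any (λ y → Q y i) ys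
  h′ i∈ with ∈-filter⁻ (¬? ∘ Q? y) {xs = is} i∈
  ... | i∈is , ¬q with h i∈is
  ...   | here q  = contradiction q ¬q
  ...   | there a = a
  lt′ : length ys * k < length (filter (¬? ∘ Q? y) is)
  lt′ with +-split {k} {suc (length ys * k)} (length (filter (Q? y) is)) (length (filter (¬? ∘ Q? y) is))
             (≤-trans (≤-reflexive (+-suc k _)) (≤-trans lt (≤-reflexive (sym (length-filters (Q? y) is)))))
  ... | inj₁ le = contradiction le ¬le
  ... | inj₂ le = le
... | y′ , φ , y∈ , q , inj = y′ , φ , there y∈ , q , inj

length-concatMap-≤ : ∀ {A B : Set} {f : A → List B} {b} xs → (∀ {x} → x ∈ˡ xs → length (f x) ≤ b) →
                     length (concatMap f xs) ≤ length xs * b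
length-concatMap-≤ [] h = z≤n
length-concatMap-≤ {f = f} (x ∷ xs) h =
  ≤-trans (≤-reflexive (length-++ (f x))) (+-mono-≤ (h (here refl)) (length-concatMap-≤ xs (h ∘ there)))

-- Each set is recovered from its code, so the positions of a duplicate-free list inject into
-- `Fin N`.
encoded⇒atMost : ∀ {n N} {P : Subset n → Set} (decode : Fin N → Subset n) →
                 (∀ {S} → P S → ∃[ c ] decode c ≡ S) → AtMost N P
encoded⇒atMost {P = P} decode enc Ss u all = injective⇒≤ {f = f} inj
  where
  code : ∀ i → ∃[ c ] decode c ≡ lookup Ss i
  code i = enc (All.lookup all (∈-lookup i))
  f = proj₁ ∘ code
  inj : Injective _≡_ _≡_ f
  inj {i} {j} e = unique-lookup u (trans (sym (proj₂ (code i))) (trans (cong decode e) (proj₂ (code j))))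

-- Minimal connected dominating sets

module Components (G : Graph) where

  Closed : Subset (order G) → Subset (order G) → Set
  Closed U C = ∀ {x y} → x ∈ C → y ∈ U → Adj G x y → y ∈ C

  closed-star : ∀ {U C x y} → Closed U C → x ∈ C → Star (AdjWithin G U) x y →
                y ∈ C × Star (AdjWithin G C) x y
  closed-star cl x∈ ε = x∈ , ε
  closed-star cl x∈ ((_ , z∈ , a) ◅ s) with cl x∈ z∈ a
  ... | z∈C with closed-star cl z∈C s
  ...   | y∈ , s′ = y∈ , (x∈ , z∈C , a) ◅ s′

  record Component (U : Subset (order G)) (v : Vertex G) : Set where
    field
      C      : Subset (order G)
      base   : v ∈ C
      within : C ⊆ U
      closed : Closed U C
      reach  : ∀ {x} → x ∈ C → Star (AdjWithin G U) v x

  abstract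
    -- Starting from the singleton of `v`, vertices of `U` are added as long as an edge leaves the
    -- set; strict growth inside a finite set ends.
    component : ∀ {U v} → v ∈ U → Component U v
    component {U} {v} v∈ = grow ⁅ v ⁆ (⊃-wellFounded _) (x∈⁅x⁆ v)
      (λ x∈ → subst (_∈ U) (sym (x∈⁅y⁆⇒x≡y v x∈)) v∈)
      (λ x∈ → subst (Star (AdjWithin G U) v) (sym (x∈⁅y⁆⇒x≡y v x∈)) ε)
      where
      grow : ∀ C → Acc (λ p q → q ⊂ p) C → v ∈ C → C ⊆ U →
             (∀ {x} → x ∈ C → Star (AdjWithin G U) v x) → Component U v
      grow C (acc rs) b w r
        with anyᶠ? (λ y → (y ∈? U) ×-dec ¬? (y ∈? C) ×-dec anyᶠ? (λ x → (x ∈? C) ×-dec adj? G x y))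
      ... | no none = record { C = C ; base = b ; within = w ; closed = cl ; reach = r }
        where
        cl : Closed U C
        cl {x} {y} x∈ y∈ a with y ∈? C
        ... | yes y∈C = y∈C
        ... | no y∉C  = contradiction (y , y∈ , y∉C , x , x∈ , a) none
      ... | yes (y , y∈U , y∉C , x , x∈C , a) =
        grow (C ∪ ⁅ y ⁆) (rs (p⊆p∪q ⁅ y ⁆ , y , q⊆p∪q C ⁅ y ⁆ (x∈⁅x⁆ y) , y∉C)) (p⊆p∪q ⁅ y ⁆ b) w′ r′
        where
        w′ : C ∪ ⁅ y ⁆ ⊆ U
        w′ z∈ with x∈p∪q⁻ C ⁅ y ⁆ z∈
        ... | inj₁ z∈C = w z∈C
        ... | inj₂ z∈y with x∈⁅y⁆⇒x≡y y z∈y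
        ...   | refl = y∈U
        r′ : ∀ {z} → z ∈ C ∪ ⁅ y ⁆ → Star (AdjWithin G U) v z
        r′ z∈ with x∈p∪q⁻ C ⁅ y ⁆ z∈
        ... | inj₁ z∈C = r z∈C
        ... | inj₂ z∈y with x∈⁅y⁆⇒x≡y y z∈y
        ...   | refl = r x∈C ◅◅ (w x∈C , y∈U , a) ◅ ε

  Connected : Subset (order G) → Set
  Connected X = ∃[ v ] (v ∈ X × (∀ {x} → x ∈ X → Star (AdjWithin G X) v x))

  Dominates : ∀ {m} → Subset (order G) → (Fin m → Vertex G) → Set
  Dominates X s = ∀ i → ∃[ u ] (u ∈ X × Adj G u (s i))

  -- For a fixed `v` in `X`, everything is reachable from `v` exactly if `X` is contained in the
  -- component of `v`.
  connected? : ∀ X → Dec (Connected X)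
  connected? X = anyᶠ? from?
    where
    from? : ∀ v → Dec (v ∈ X × (∀ {x} → x ∈ X → Star (AdjWithin G X) v x))
    from? v with v ∈? X
    ... | no v∉  = no (v∉ ∘ proj₁)
    ... | yes v∈ = map′ (λ X⊆C → v∈ , λ {x} x∈ → reach (X⊆C {x} x∈))
                        (λ p {x} x∈ → proj₁ (closed-star closed base (proj₂ p {x} x∈)))
                        (X ⊆? C)
      where open Component (component v∈)

  dominatedBy? : ∀ X y → Dec (∃[ u ] (u ∈ X × Adj G u y))
  dominatedBy? X y = anyᶠ? (λ u → (u ∈? X) ×-dec adj? G u y)

  dominates? : ∀ {m} X (s : Fin m → Vertex G) → Dec (Dominates X s)
  dominates? X s = allᶠ? (λ i → dominatedBy? X (s i))

  flip-star : ∀ {X x y} → Star (AdjWithin G X) x y → Star (AdjWithin G X) y x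
  flip-star = Star.reverse (λ (x∈ , y∈ , a) → y∈ , x∈ , adj-sym G a)

  joined : ∀ {X} → Connected X → ∀ {x y} → x ∈ X → y ∈ X → Star (AdjWithin G X) x y
  joined (v , _ , r) x∈ y∈ = flip-star (r x∈) ◅◅ r y∈

  record Connector {m} (s : Fin m → Vertex G) (X : Subset (order G)) : Set where
    field
      connected : Connected X
      dominates : Dominates X s

  record MinimalConnector {m} (s : Fin m → Vertex G) (X : Subset (order G)) : Set where
    field
      connector : Connector s X
      minimal   : ∀ {Z} → Z ⊂ X → ¬ Connector s Z

    open Connector connector public

  connector? : ∀ {m} (s : Fin m → Vertex G) X → Dec (Connector s X)
  connector? s X = map′ (λ (c , d) → record { connected = c ; dominates = d })
                        (λ c → Connector.connected c , Connector.dominates c)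
                        (connected? X ×-dec dominates? X s)

  minimize : ∀ {m} {s : Fin m → Vertex G} {X} → Connector s X →
             ∃[ Y ] (Y ⊆ X × MinimalConnector s Y)
  minimize {s = s} {X} = go X (⊂-wellFounded X)
    where
    go : ∀ X → Acc _⊂_ X → Connector s X → ∃[ Y ] (Y ⊆ X × MinimalConnector s Y)
    go X (acc rs) c with anySubset? (λ Z → (Z ⊂? X) ×-dec connector? s Z)
    ... | no none = X , (λ x∈ → x∈) , record { connector = c ; minimal = λ {Z} Z⊂X cZ → none (Z , Z⊂X , cZ) }
    ... | yes (Z , Z⊂X , cZ) with go Z (rs Z⊂X) cZ
    ...   | Y , Y⊆Z , mY = Y , (λ y∈ → proj₁ Z⊂X (Y⊆Z y∈)) , mY

-- Legs and fans of legs

module Legs (G : Graph) {m : ℕ} (s : Fin m → Vertex G) {Y : Subset (order G)}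
            (mc : Components.MinimalConnector G s Y) (s∉ : ∀ i → s i ∉ Y) where
  open Paths G
  open Components G
  open MinimalConnector mc

  -- C is the component of v in Y − q.
  record Leg (v q : Vertex G) : Set where
    field
      C       : Subset (order G)
      v∈C     : v ∈ C
      q∉C     : q ∉ C
      closed  : ∀ {x y} → x ∈ C → y ∈ Y → y ≢ q → Adj G x y → y ∈ C
      t       : Fin m
      private-t : ∀ {x} → x ∈ C → ¬ Adj G x (s t)
      outside : ∀ {x} → x ∈ Y → x ∉ C → Walk (λ z → z ∈ Y × z ∉ C) x q
      tail    : List (Vertex G)
      path    : IPath q tail (s t)
      inside  : ∀ {x} → x ∈ˡ q ∷ tail → x ≡ s t ⊎ (x ∈ Y × x ∉ C)

  -- The component `C` is connected and misses `q`, so by minimality of `Y` it fails to dominate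
  -- some `s t`. A neighbour of `s t` in `Y` then lies outside `C` and is joined to `q` outside `C`,
  -- which gives the leg.
  separate : ∀ {v q} → v ∈ Y → q ∈ Y → v ≢ q → Leg v q
  separate {v} {q} v∈Y q∈Y v≢q = record
    { C = C ; v∈C = base ; q∉C = q∉C ; closed = cl ; t = t
    ; private-t = λ x∈ a → ¬dom (_ , x∈ , a)
    ; outside = out ; tail = proj₁ tp ; path = proj₁ (proj₂ tp) ; inside = swap ∘ proj₂ (proj₂ tp) }
    where
    open Component (component {U = Y ∩ ∁ ⁅ q ⁆} (x∈p∩q⁺ (v∈Y , x∉p⇒x∈∁p (v≢q ∘ x∈⁅y⁆⇒x≡y q))))
    q∉C : q ∉ C
    q∉C q∈ = x∈∁p⇒x∉p (proj₂ (x∈p∩q⁻ Y _ (within q∈))) (x∈⁅x⁆ q)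
    C⊂Y : C ⊂ Y
    C⊂Y = (λ x∈ → proj₁ (x∈p∩q⁻ Y _ (within x∈))) , q , q∈Y , q∉C
    conC : Connected C
    conC = v , base , λ x∈ → proj₂ (closed-star closed base (reach x∈))
    undominated : ∃[ i ] ¬ (∃[ u ] (u ∈ C × Adj G u (s i)))
    undominated = ¬∀⟶∃¬ m _ (λ i → dominatedBy? C (s i))
      (λ d → minimal C⊂Y (record { connected = conC ; dominates = d }))
    t = proj₁ undominated
    ¬dom = proj₂ undominated
    cl : ∀ {x y} → x ∈ C → y ∈ Y → y ≢ q → Adj G x y → y ∈ C
    cl x∈ y∈ y≢q a = closed x∈ (x∈p∩q⁺ (y∈ , x∉p⇒x∈∁p (y≢q ∘ x∈⁅y⁆⇒x≡y q))) a
    D : Pred (Vertex G) 0ℓ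
    D z = z ∈ Y × z ∉ C
    -- Apart from `q`, no vertex of `Y` outside `C` has a neighbour in `C`; a walk to `v` from
    -- outside must therefore visit `q` before it enters `C`.
    out′ : ∀ {x} → x ∈ Y → Star (AdjWithin G Y) x v → x ∈ C ⊎ Walk D x q
    out′ x∈ ε = inj₁ base
    out′ {x} x∈ ((_ , y∈ , a) ◅ st) with x ≟ᶠ q
    ... | yes refl = inj₂ ε
    ... | no x≢q with x ∈? C
    ...   | yes x∈C = inj₁ x∈C
    ...   | no x∉C with out′ y∈ st
    ...     | inj₁ y∈C = contradiction (cl y∈C x∈ x≢q (adj-sym G a)) x∉C
    ...     | inj₂ ε   = inj₂ (((x∈ , x∉C) , (q∈Y , q∉C) , a) ◅ ε)
    ...     | inj₂ w@((Dy , _) ◅ _) = inj₂ (((x∈ , x∉C) , Dy , a) ◅ w)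
    out : ∀ {x} → x ∈ Y → x ∉ C → Walk D x q
    out x∈ x∉ with out′ x∈ (joined connected x∈ v∈Y)
    ... | inj₁ x∈C = contradiction x∈C x∉
    ... | inj₂ w   = w
    P : Pred (Vertex G) 0ℓ
    P z = D z ⊎ z ≡ s t
    tp : ∃[ xs ] (IPath q xs (s t) × (∀ {x} → x ∈ˡ q ∷ xs → P x))
    tp with dominates t
    ... | d , d∈ , a = walk⇒path
      (Star.reverse (λ (x∈ , y∈ , b) → inj₁ y∈ , inj₁ x∈ , adj-sym G b) (out d∈ d∉)
        ◅◅ (inj₁ (d∈ , d∉) , inj₂ refl , a) ◅ ε)
      (inj₁ (q∈Y , q∉C))
      where
      d∉ : d ∉ C
      d∉ d∈C = ¬dom (d , d∈C , a)

  abstract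
    leg : ∀ {v q} → v ∈ Y → q ∈ Y → v ≢ q → Leg v q
    leg = separate

  module Pair {v q v′ q′ : Vertex G} (ℓ : Leg v q) (ℓ′ : Leg v′ q′)
              (q′∈ : q′ ∈ Leg.C ℓ) (q∈′ : q ∈ Leg.C ℓ′) where
    private
      module ℓ  = Leg ℓ
      module ℓ′ = Leg ℓ′

    -- In other words, the sets Y ∖ C of the two legs are disjoint.
    swap∈ : ∀ {x} → x ∈ Y → x ∉ ℓ.C → x ∈ ℓ′.C
    swap∈ {x} x∈ x∉ = go x∈ x∉ (ℓ.outside x∈ x∉)
      where
      -- Membership in `ℓ′.C` spreads from `q` back along the walk: the walk avoids `ℓ.C`, hence
      -- also `q′`, the only vertex at which closedness of `ℓ′.C` could fail.
      go : ∀ {x} → x ∈ Y → x ∉ ℓ.C → Walk (λ z → z ∈ Y × z ∉ ℓ.C) x q → x ∈ ℓ′.C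
      go _ _ ε = q∈′
      go x∈ x∉ ((_ , (y∈ , y∉) , a) ◅ w) =
        ℓ′.closed (go y∈ y∉ w) x∈ (λ { refl → x∉ q′∈ }) (adj-sym G a)

  module _ {v q v′ q′ : Vertex G} (ℓ : Leg v q) (ℓ′ : Leg v′ q′)
           (q′∈ : q′ ∈ Leg.C ℓ) (q∈′ : q ∈ Leg.C ℓ′) where
    private
      module ℓ  = Leg ℓ
      module ℓ′ = Leg ℓ′
      module P  = Pair ℓ ℓ′ q′∈ q∈′
      module P′ = Pair ℓ′ ℓ q∈′ q′∈

    -- A neighbour of `s ℓ.t` in `Y` lies outside `ℓ.C`, hence inside `ℓ′.C`, where nothing is
    -- adjacent to `s ℓ′.t`.
    legs-distinct : s ℓ.t ≢ s ℓ′.t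
    legs-distinct eq with dominates ℓ.t
    ... | d , d∈ , a = ℓ′.private-t (P.swap∈ d∈ (λ d∈C → ℓ.private-t d∈C a)) (subst (Adj G d) eq a)

    -- The part of each leg in `Y` lies in the `C` of the other. There it is invisible to the other
    -- leg's end in S, and by closedness an edge to a vertex other than `q` or `q′` would pull that
    -- vertex into the `C` it avoids.
    legs-cross : ∀ {x y} → x ∈ˡ q ∷ ℓ.tail → y ∈ˡ q′ ∷ ℓ′.tail → Touch x y →
                 (x ≡ q × y ≡ q′) ⊎ (x ≡ s ℓ.t × y ≡ s ℓ′.t)
    legs-cross {x} {y} x∈ y∈ t with ℓ.inside x∈ | ℓ′.inside y∈ | t
    ... | inj₁ x≡ | inj₁ y≡ | _ = inj₂ (x≡ , y≡)
    ... | inj₁ refl | inj₂ (y∈Y , y∉) | inj₁ refl = contradiction y∈Y (s∉ _)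
    ... | inj₁ refl | inj₂ (y∈Y , y∉) | inj₂ a = contradiction (adj-sym G a) (ℓ.private-t (P′.swap∈ y∈Y y∉))
    ... | inj₂ (x∈Y , x∉) | inj₁ refl | inj₁ refl = contradiction x∈Y (s∉ _)
    ... | inj₂ (x∈Y , x∉) | inj₁ refl | inj₂ a = contradiction a (ℓ′.private-t (P.swap∈ x∈Y x∉))
    ... | inj₂ (x∈Y , x∉) | inj₂ (y∈Y , y∉) | inj₁ refl = contradiction (P.swap∈ x∈Y x∉) y∉
    ... | inj₂ (x∈Y , x∉) | inj₂ (y∈Y , y∉) | inj₂ a with x ≟ᶠ q | y ≟ᶠ q′
    ...   | yes x≡ | yes y≡ = inj₁ (x≡ , y≡)
    ...   | no x≢  | _      = contradiction (ℓ.closed (P′.swap∈ y∈Y y∉) x∈Y x≢ (adj-sym G a)) x∉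
    ...   | _      | no y≢  = contradiction (ℓ′.closed (P.swap∈ x∈Y x∉) y∈Y y≢ a) y∉

  -- Since `v` lies in `C`, it is not adjacent to `s t`, and its only possible neighbour in `Y`
  -- outside `C` is `q`.
  leg-apex : ∀ {v q x} (ℓ : Leg v q) → v ∈ Y → x ∈ˡ q ∷ Leg.tail ℓ → Touch v x → x ≡ q
  leg-apex {v} {q} {x} ℓ v∈Y x∈ t with Leg.inside ℓ x∈ | t
  ... | inj₁ x≡   | inj₁ v≡x  = contradiction (subst (_∈ Y) (trans v≡x x≡) v∈Y) (s∉ _)
  ... | inj₁ refl | inj₂ a    = contradiction a (Leg.private-t ℓ (Leg.v∈C ℓ))
  ... | inj₂ (x∈Y , x∉) | inj₁ refl = contradiction (Leg.v∈C ℓ) x∉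
  ... | inj₂ (x∈Y , x∉) | inj₂ a with x ≟ᶠ q
  ...   | yes x≡ = x≡
  ...   | no x≢  = contradiction (Leg.closed ℓ (Leg.v∈C ℓ) x∈Y x≢ a) x∉

  leg-long : ∀ {v q} (ℓ : Leg v q) → q ∈ Y → 1 ≤ length (Leg.tail ℓ)
  leg-long ℓ q∈ = nontrivial (Leg.path ℓ) (λ eq → s∉ _ (subst (_∈ Y) eq q∈))

  module Fan {a : ℕ} {v : Vertex G} (v∈Y : v ∈ Y) (q : Fin a → Vertex G) (q∈ : ∀ i → q i ∈ Y)
             (vq : ∀ i → Adj G v (q i)) (q-distinct : ∀ {i j} → i ≢ j → q i ≢ q j) where

    legs : ∀ i → Leg v (q i)
    legs i = leg v∈Y (q∈ i) (λ eq → adj-irrefl G v (subst (Adj G v) (sym eq) (vq i)))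

    t : Fin a → Fin m
    t i = Leg.t (legs i)

    -- The edge from `v` to `q j` survives the removal of `q i`; this is what makes the legs
    -- pairwise independent.
    other : ∀ {i j} → i ≢ j → q j ∈ Leg.C (legs i)
    other {i} {j} i≢j = Leg.closed (legs i) (Leg.v∈C (legs i)) (q∈ j) (q-distinct (i≢j ∘ sym)) (vq j)

    t-distinct : ∀ {i j} → i ≢ j → s (t i) ≢ s (t j)
    t-distinct i≢j = legs-distinct (legs _) (legs _) (other i≢j) (other (i≢j ∘ sym))

    cross : ∀ {i j x y} → i ≢ j → x ∈ˡ q i ∷ Leg.tail (legs i) → y ∈ˡ q j ∷ Leg.tail (legs j) → Touch x y →
            (x ≡ q i × y ≡ q j) ⊎ (x ≡ s (t i) × y ≡ s (t j))
    cross i≢j = legs-cross (legs _) (legs _) (other i≢j) (other (i≢j ∘ sym))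

    in-or-end : ∀ i {x} → x ∈ˡ q i ∷ Leg.tail (legs i) → x ≡ s (t i) ⊎ x ∈ Y
    in-or-end i x∈ with Leg.inside (legs i) x∈
    ... | inj₁ x≡        = inj₁ x≡
    ... | inj₂ (x∈Y , _) = inj₂ x∈Y

    fan-clique : IsClique G q → Half G clique 1 a (s ∘ t) (_∈ Y)
    fan-clique cl = record
      { e = q ; tail = λ i → Leg.tail (legs i) ; path = λ i → Leg.path (legs i) ; joint = cl
      ; long = λ i → leg-long (legs i) (q∈ i) ; inside = in-or-end ; cross = cross }

    -- Prepending `v` makes the legs start at a common vertex, and stability removes the contacts
    -- between `q i` and `q j`.
    fan-star : (∀ {i j} → i ≢ j → ¬ Adj G (q i) (q j)) → Half G star 2 a (s ∘ t) (_∈ Y)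
    fan-star st = record
      { e = λ _ → v ; tail = λ i → q i ∷ Leg.tail (legs i)
      ; path = λ i → step (vq i)
          (λ x∈ → (λ { refl → v∉ i x∈ }) , λ adj → leg-apex (legs i) v∈Y x∈ (inj₂ adj))
          (Leg.path (legs i))
      ; joint = λ _ _ → refl
      ; long = λ i → s≤s (leg-long (legs i) (q∈ i))
      ; inside = λ { i (here refl) → inj₂ v∈Y ; i (there x∈) → in-or-end i x∈ }
      ; cross = λ { i≢j (here x≡) _ _ → inj₁ (inj₁ x≡)
                  ; i≢j (there x∈) (here y≡) _ → inj₁ (inj₂ y≡)
                  ; {i} {j} i≢j (there x∈) (there y∈) tc → inj₂ (strip i≢j (cross i≢j x∈ y∈ tc) tc) } }
      where
      v∉ : ∀ i → v ∉ˡ q i ∷ Leg.tail (legs i)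
      v∉ i v∈ = adj-irrefl G v (subst (Adj G v) (sym (leg-apex (legs i) v∈Y v∈ (inj₁ refl))) (vq i))
      strip : ∀ {i j x y} → i ≢ j → (x ≡ q i × y ≡ q j) ⊎ (x ≡ s (t i) × y ≡ s (t j)) → Touch x y →
              x ≡ s (t i) × y ≡ s (t j)
      strip i≢j (inj₁ (refl , refl)) (inj₁ e) = contradiction e (q-distinct i≢j)
      strip i≢j (inj₁ (refl , refl)) (inj₂ a) = contradiction a (st i≢j)
      strip i≢j (inj₂ p) _ = p

-- Long induced paths and induced cycles

-- The geometric sum 1 + K + ... + K^d, which counts walks of at most d edges from a vertex when all
-- degrees are at most K.
ballBound : ℕ → ℕ → ℕ
ballBound K zero    = 1
ballBound K (suc d) = suc (K * ballBound K d)

module LongPaths (G : Graph) {m : ℕ} (s : Fin m → Vertex G) {Y Z : Subset (order G)}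
                 (mc : Components.MinimalConnector G s Y) (s∉Y : ∀ i → s i ∉ Y)
                 (opposite : Components.Connector G s Z) (s∉Z : ∀ i → s i ∉ Z)
                 (anti : ∀ {x y} → x ∈ Y → y ∈ Z → ¬ Paths.Touch G x y) where
  open Paths G
  open Components G
  open MinimalConnector mc
  open Legs G s mc s∉Y

  tail⊆C : ∀ {v q xs w} (ℓ : Leg v q) → IPath v xs w → (∀ {x} → x ∈ˡ v ∷ xs → x ∈ Y × q ≢ x) →
           ∀ {x} → x ∈ˡ v ∷ xs → x ∈ Leg.C ℓ
  tail⊆C {q = q} ℓ p ok = go p ok (Leg.v∈C ℓ)
    where
    go : ∀ {v xs w} → IPath v xs w → (∀ {x} → x ∈ˡ v ∷ xs → x ∈ Y × q ≢ x) → v ∈ Leg.C ℓ →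
         ∀ {x} → x ∈ˡ v ∷ xs → x ∈ Leg.C ℓ
    go p ok v∈ (here refl) = v∈
    go (step a _ p) ok v∈ (there x∈) =
      go p (ok ∘ there) (Leg.closed ℓ v∈ (proj₁ next) (proj₂ next ∘ sym) a) x∈
      where next = ok (there (here refl))

  -- An induced path in Y is prolonged by a leg at either end to vertices s t₀
  -- and s t₁; an induced path between these through Z closes a cycle, and
  -- is the single edge s t₀ s t₁ if that is present.
  path⇒hole : ∀ {u xs w} → IPath u xs w → (∀ {x} → x ∈ˡ u ∷ xs → x ∈ Y) → 1 ≤ length xs →
              ∃[ n ] (length xs ≤ 3 + n × (cycleGraph n ⊑ G))
  path⇒hole {u} {v ∷ xs} {w} p@(step uv c p₁) inY _ with reversal p
  ... | [] , _ , _ , _ , ()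
  ... | v′ ∷ ys , r@(step wv′ c′ r₁) , sub , sup , _ = result
    where
    u∈Y : u ∈ Y
    u∈Y = inY (here refl)
    w∈Y : w ∈ Y
    w∈Y = inY (sub (here refl))
    -- Taking the component of the second vertex `v` places the whole path except `u` inside `ℓ₀.C`;
    -- `ℓ₁` is chosen likewise from the other end.
    ℓ₀ : Leg v u
    ℓ₀ = leg (inY (there (here refl))) u∈Y (proj₁ (c (here refl)) ∘ sym)
    ℓ₁ : Leg v′ w
    ℓ₁ = leg (inY (sub (there (here refl)))) w∈Y (proj₁ (c′ (here refl)) ∘ sym)
    module ℓ₀ = Leg ℓ₀
    module ℓ₁ = Leg ℓ₁
    in₀ : ∀ {x} → x ∈ˡ v ∷ xs → x ∈ ℓ₀.C
    in₀ = tail⊆C ℓ₀ p₁ (λ x∈ → inY (there x∈) , proj₁ (c x∈))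
    in₁′ : ∀ {x} → x ∈ˡ v′ ∷ ys → x ∈ ℓ₁.C
    in₁′ = tail⊆C ℓ₁ r₁ (λ x∈ → inY (sub (there x∈)) , proj₁ (c′ x∈))
    in₁ : ∀ {x} → x ∈ˡ u ∷ v ∷ xs → x ≢ w → x ∈ ℓ₁.C
    in₁ x∈ x≢w with sup x∈
    ... | here x≡   = contradiction x≡ x≢w
    ... | there x∈r = in₁′ x∈r
    w∈₀ : w ∈ ℓ₀.C
    w∈₀ = in₀ (end∈ p₁)
    u∈₁ : u ∈ ℓ₁.C
    u∈₁ = in₁ (here refl) (λ { refl → ℓ₀.q∉C w∈₀ })
    module P  = Pair ℓ₀ ℓ₁ w∈₀ u∈₁
    module P′ = Pair ℓ₁ ℓ₀ u∈₁ w∈₀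
    s₀ = s ℓ₀.t
    s₁ = s ℓ₁.t
    s₀≢s₁ : s₀ ≢ s₁
    s₀≢s₁ = legs-distinct ℓ₀ ℓ₁ w∈₀ u∈₁

    -- The leg at u, read backwards and without its end s₀.
    record Stub : Set where
      field
        {d}     : Vertex G
        {ds}    : List (Vertex G)
        stub    : IPath d ds u
        s₀d     : Adj G s₀ d
        only-d  : ∀ {x} → x ∈ˡ d ∷ ds → Adj G s₀ x → x ≡ d
        stub∈   : ∀ {x} → x ∈ˡ d ∷ ds → x ∈ Y × x ∉ ℓ₀.C

    stub : Stub
    stub with reversal ℓ₀.path
    ... | rs , q , sub₀ , _ = peel q sub₀ refl
      where
      peel : ∀ {z rs} → IPath z rs u → (∀ {x} → x ∈ˡ z ∷ rs → x ∈ˡ u ∷ ℓ₀.tail) → z ≡ s₀ → Stub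
      peel stop _ z≡ = contradiction (subst (_∈ Y) z≡ u∈Y) (s∉Y _)
      peel (step a cq q) sub₀ refl = record
        { stub = q ; s₀d = a ; only-d = λ x∈ → proj₂ (cq x∈) ; stub∈ = mem }
        where
        mem : ∀ {x} → x ∈ˡ _ → x ∈ Y × x ∉ ℓ₀.C
        mem x∈ with ℓ₀.inside (sub₀ (there x∈))
        ... | inj₁ x≡ = contradiction (sym x≡) (proj₁ (cq x∈))
        ... | inj₂ y  = y
    open Stub stub renaming (stub to q₀)

    A₁ : IPath d (ds ++ v ∷ xs) w
    A₁ = concat q₀ p apart
      where
      apart : ∀ {x y} → x ∈ˡ d ∷ ds → x ≢ u → y ∈ˡ v ∷ xs → ¬ Touch x y
      apart x∈ x≢u y∈ (inj₁ refl) = proj₂ (stub∈ x∈) (in₀ y∈)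
      apart x∈ x≢u y∈ (inj₂ a)    =
        proj₂ (stub∈ x∈) (ℓ₀.closed (in₀ y∈) (proj₁ (stub∈ x∈)) x≢u (adj-sym G a))

    A₁∈Y : ∀ {x} → x ∈ˡ d ∷ ds ++ v ∷ xs → x ∈ Y
    A₁∈Y x∈ with ∈-++⁻ (d ∷ ds) x∈
    ... | inj₁ x∈q = proj₁ (stub∈ x∈q)
    ... | inj₂ x∈p = inY (there x∈p)

    A₁∈C₁ : ∀ {x} → x ∈ˡ d ∷ ds ++ v ∷ xs → x ≢ w → x ∈ ℓ₁.C
    A₁∈C₁ x∈ x≢w with ∈-++⁻ (d ∷ ds) x∈
    ... | inj₁ x∈q = P.swap∈ (proj₁ (stub∈ x∈q)) (proj₂ (stub∈ x∈q))
    ... | inj₂ x∈p = in₁ (there x∈p) x≢w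

    as : List (Vertex G)
    as = (ds ++ v ∷ xs) ++ ℓ₁.tail

    A₂ : IPath d as s₁
    A₂ = concat A₁ ℓ₁.path apart
      where
      apart : ∀ {x y} → x ∈ˡ d ∷ ds ++ v ∷ xs → x ≢ w → y ∈ˡ ℓ₁.tail → ¬ Touch x y
      apart x∈ x≢w y∈ t with ℓ₁.inside (there y∈) | t
      ... | inj₁ refl | inj₁ refl = s∉Y _ (A₁∈Y x∈)
      ... | inj₁ refl | inj₂ a    = ℓ₁.private-t (A₁∈C₁ x∈ x≢w) a
      ... | inj₂ (y∈Y , y∉) | inj₁ refl = y∉ (A₁∈C₁ x∈ x≢w)
      ... | inj₂ (y∈Y , y∉) | inj₂ a =
        y∉ (ℓ₁.closed (A₁∈C₁ x∈ x≢w) y∈Y (λ { refl → start∉tail ℓ₁.path y∈ }) a)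

    A₂∈ : ∀ {x} → x ∈ˡ d ∷ as → x ∈ Y ⊎ x ≡ s₁
    A₂∈ x∈ with ∈-++⁻ (d ∷ ds ++ v ∷ xs) x∈
    ... | inj₁ x∈A = inj₁ (A₁∈Y x∈A)
    ... | inj₂ x∈ℓ with ℓ₁.inside (there x∈ℓ)
    ...   | inj₁ x≡        = inj₂ x≡
    ...   | inj₂ (x∈Y , _) = inj₁ x∈Y

    s₀∉A₂ : ∀ {x} → x ∈ˡ d ∷ as → s₀ ≢ x
    s₀∉A₂ x∈ eq with A₂∈ x∈
    ... | inj₁ x∈Y = s∉Y _ (subst (_∈ Y) (sym eq) x∈Y)
    ... | inj₂ x≡  = s₀≢s₁ (trans eq x≡)

    s₀-A₂ : ∀ {x} → x ∈ˡ d ∷ as → Adj G s₀ x → x ≡ d ⊎ x ≡ s₁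
    s₀-A₂ x∈ a with ∈-++⁻ (d ∷ ds ++ v ∷ xs) x∈
    ... | inj₂ x∈ℓ with ℓ₁.inside (there x∈ℓ)
    ...   | inj₁ x≡         = inj₂ x≡
    ...   | inj₂ (x∈Y , x∉) = contradiction (adj-sym G a) (ℓ₀.private-t (P′.swap∈ x∈Y x∉))
    s₀-A₂ x∈ a | inj₁ x∈A with ∈-++⁻ (d ∷ ds) x∈A
    ... | inj₁ x∈q = inj₁ (only-d x∈q a)
    ... | inj₂ x∈p = contradiction (adj-sym G a) (ℓ₀.private-t (in₀ x∈p))

    -- The way back from s₀ to s₁, without its start s₀.
    record Return : Set where
      field
        {b}    : Vertex G
        {bs}   : List (Vertex G)
        path   : IPath b bs s₁
        s₀b    : Adj G s₀ b
        s₀≢    : ∀ {x} → x ∈ˡ b ∷ bs → s₀ ≢ x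
        only-b : ∀ {x} → x ∈ˡ b ∷ bs → Adj G s₀ x → x ≡ b
        path∈  : ∀ {x} → x ∈ˡ b ∷ bs → x ∈ Z ⊎ x ≡ s₁

    return : Return
    return with Connector.dominates opposite ℓ₀.t | Connector.dominates opposite ℓ₁.t
    ... | z₀ , z₀∈ , a₀ | z₁ , z₁∈ , a₁ = peel (walk⇒path walk (inj₂ (inj₁ refl)))
      where
      Q : Pred (Vertex G) 0ℓ
      Q x = x ∈ Z ⊎ x ≡ s₀ ⊎ x ≡ s₁
      walk : Walk Q s₀ s₁
      walk = (inj₂ (inj₁ refl) , inj₁ z₀∈ , adj-sym G a₀) ◅
             (Star.map (λ (x∈ , y∈ , a) → inj₁ x∈ , inj₁ y∈ , a) (joined (Connector.connected opposite) z₀∈ z₁∈)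
              ◅◅ (inj₁ z₁∈ , inj₂ (inj₂ refl) , a₁) ◅ ε)
      peel′ : ∀ {z bs} → IPath z bs s₁ → (∀ {x} → x ∈ˡ z ∷ bs → Q x) → z ≡ s₀ → Return
      peel′ stop _ z≡ = contradiction (sym z≡) s₀≢s₁
      peel′ (step a cb pb) all refl = record
        { path = pb ; s₀b = a ; s₀≢ = λ x∈ → proj₁ (cb x∈) ; only-b = λ x∈ → proj₂ (cb x∈) ; path∈ = mem }
        where
        mem : ∀ {x} → x ∈ˡ _ → x ∈ Z ⊎ x ≡ s₁
        mem x∈ with all (there x∈)
        ... | inj₁ x∈Z        = inj₁ x∈Z
        ... | inj₂ (inj₁ x≡)  = contradiction (sym x≡) (proj₁ (cb x∈))
        ... | inj₂ (inj₂ x≡)  = inj₂ x≡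
      peel : ∃[ bs ] (IPath s₀ bs s₁ × (∀ {x} → x ∈ˡ s₀ ∷ bs → Q x)) → Return
      peel (bs , p , all) = peel′ p all refl
    open Return return renaming (path to pb)

    result : ∃[ n ] (length (v ∷ xs) ≤ 3 + n × (cycleGraph n ⊑ G))
    result with reversal A₂
    ... | rs , q , subA , _ , len = n , ≤-trans long n≥ , cyc
      where
      q∈Y : ∀ {x} → x ∈ˡ rs → x ∈ Y
      q∈Y x∈ with A₂∈ (subA (there x∈))
      ... | inj₁ x∈Y  = x∈Y
      ... | inj₂ refl = contradiction x∈ (start∉tail q)
      -- The way back from `b` to `s₁`, then `A₂` in reverse from `s₁` to `d`. The apex `s₀` sees
      -- only the two ends; if it is adjacent to `s₁`, then `b` is `s₁`.
      F : IPath b (bs ++ rs) d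
      F = concat pb q apart
        where
        apart : ∀ {x y} → x ∈ˡ b ∷ bs → x ≢ s₁ → y ∈ˡ rs → ¬ Touch x y
        apart x∈ x≢ y∈ t with path∈ x∈
        ... | inj₁ x∈Z = anti (q∈Y y∈) x∈Z (touch-sym t)
        ... | inj₂ x≡  = x≢ x≡
      d∈Y : d ∈ Y
      d∈Y = A₁∈Y (here refl)
      b≢d : b ≢ d
      b≢d b≡d with path∈ (here refl)
      ... | inj₁ b∈Z = anti d∈Y b∈Z (inj₁ (sym b≡d))
      ... | inj₂ b≡  = s∉Y _ (subst (_∈ Y) (trans (sym b≡d) b≡) d∈Y)
      z∉ : ∀ {x} → x ∈ˡ b ∷ bs ++ rs → s₀ ≢ x
      z∉ x∈ with ∈-++⁻ (b ∷ bs) x∈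
      ... | inj₁ x∈b = s₀≢ x∈b
      ... | inj₂ x∈r = s₀∉A₂ (subA (there x∈r))
      only : ∀ {x} → x ∈ˡ b ∷ bs ++ rs → Adj G s₀ x → x ≡ b ⊎ x ≡ d
      only x∈ a with ∈-++⁻ (b ∷ bs) x∈
      ... | inj₁ x∈b = inj₁ (only-b x∈b a)
      ... | inj₂ x∈r with s₀-A₂ (subA (there x∈r)) a
      ...   | inj₁ x≡d  = inj₂ x≡d
      ...   | inj₂ refl = contradiction x∈r (start∉tail q)
      H = hole F b≢d z∉ s₀b s₀d only
      n = proj₁ H
      n≥ = proj₁ (proj₂ H)
      cyc = proj₂ (proj₂ H)
      long : length (v ∷ xs) ≤ length (bs ++ rs)
      long = ≤-trans (m≤n+m _ (length ds)) (≤-trans (≤-reflexive (sym (length-++ ds)))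
            (≤-trans (m≤m+n _ (length ℓ₁.tail)) (≤-trans (≤-reflexive (sym (length-++ (ds ++ v ∷ xs))))
            (≤-trans (≤-reflexive (sym len)) (≤-trans (m≤n+m _ (length bs)) (≤-reflexive (sym (length-++ bs))))))))

  neighbours : Vertex G → List (Vertex G)
  neighbours v = filter (λ x → (x ∈? Y) ×-dec adj? G v x) (allFin (order G))

  reachable : ℕ → Vertex G → List (Vertex G)
  reachable zero    v = [ v ]
  reachable (suc d) v = v ∷ concatMap (reachable d) (neighbours v)

  neighbours⁻ : ∀ {v x} → x ∈ˡ neighbours v → x ∈ Y × Adj G v x
  neighbours⁻ {v} x∈ = proj₂ (∈-filter⁻ (λ x → (x ∈? Y) ×-dec adj? G v x) {xs = allFin (order G)} x∈)

  length-reachable : ∀ {K} → (∀ {v} → v ∈ Y → length (neighbours v) ≤ K) →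
                     ∀ d {v} → v ∈ Y → length (reachable d v) ≤ ballBound K d
  length-reachable deg zero    v∈ = ≤-refl
  length-reachable {K} deg (suc d) {v} v∈ = s≤s (≤-trans
    (length-concatMap-≤ (neighbours v) (λ x∈ → length-reachable deg d (proj₁ (neighbours⁻ x∈))))
    (*-monoˡ-≤ (ballBound K d) (deg v∈)))

  ∈-reachable : ∀ {u xs w} d → IPath u xs w → (∀ {x} → x ∈ˡ u ∷ xs → x ∈ Y) → length xs ≤ d →
                w ∈ˡ reachable d u
  ∈-reachable zero    stop _ _ = here refl
  ∈-reachable (suc d) stop _ _ = here refl
  ∈-reachable (suc d) (step {u} {v} a _ p) inY (s≤s le) =
    there (∈-concatMap⁺ (reachable d) (Any.map (λ { refl → ∈-reachable d p (inY ∘ there) le }) v∈))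
    where
    v∈ : v ∈ˡ neighbours u
    v∈ = ∈-filter⁺ (λ x → (x ∈? Y) ×-dec adj? G u x) (∈-allFin v) (inY (there (here refl)) , a)

  reachable⊆Y : ∀ d {v x} → v ∈ Y → x ∈ˡ reachable d v → x ∈ Y
  reachable⊆Y zero    v∈ (here refl) = v∈
  reachable⊆Y (suc d) v∈ (here refl) = v∈
  reachable⊆Y (suc d) {v} v∈ (there x∈) with ∈-concat (neighbours v) x∈
    where
    ∈-concat : ∀ vs {x} → x ∈ˡ concatMap (reachable d) vs → ∃[ y ] (y ∈ˡ vs × x ∈ˡ reachable d y)
    ∈-concat vs x∈ = find (∈-concatMap⁻ (reachable d) {xs = vs} x∈)
  ... | y , y∈ , x∈y = reachable⊆Y d (proj₁ (neighbours⁻ y∈)) x∈y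

  SmallDominator : ℕ → Set
  SmallDominator c = ∃[ ys ] (length ys ≤ c × (∀ {y} → y ∈ˡ ys → y ∈ Y) × (∀ i → Any (λ y → Adj G y (s i)) ys))

  BigHalf : ℕ → Set
  BigHalf a = ∃[ κ ] Σ[ t ∈ (Fin a → Fin m) ]
    ((∀ {i j} → i ≢ j → s (t i) ≢ s (t j)) × Half G κ (startLong κ) a (s ∘ t) (_∈ Y))

  -- If all degrees in `Y` are small, the ball of radius `r` is all of `Y`, since an induced path
  -- with more than `r` edges would give a forbidden cycle. Otherwise Ramsey among the neighbours of
  -- one vertex selects a fan.
  dichotomy : ∀ {r} → C≥Free r G → ∀ a → SmallDominator (ballBound (ram a a) r) ⊎ BigHalf a
  dichotomy {r} free a with anyᶠ? (λ v → (v ∈? Y) ×-dec (ram a a ≤? length (neighbours v)))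
  ... | no none = inj₁ (reachable r v₀ , length-reachable small r v₀∈ , reachable⊆Y r v₀∈ , dom)
    where
    v₀ = proj₁ connected
    v₀∈ = proj₁ (proj₂ connected)
    small : ∀ {v} → v ∈ Y → length (neighbours v) ≤ ram a a
    small {v} v∈ with ram a a ≤? length (neighbours v)
    ... | yes le = contradiction (v , v∈ , le) none
    ... | no ¬le = <⇒≤ (≰⇒> ¬le)
    covered : ∀ {y} → y ∈ Y → y ∈ˡ reachable r v₀
    covered y∈ with walk⇒path (joined connected v₀∈ y∈) v₀∈
    ... | xs , p , inY with length xs ≤? r
    ...   | yes le = ∈-reachable r p inY le
    ...   | no ¬le with path⇒hole p inY (≤-trans (s≤s z≤n) (≰⇒> ¬le))
    ...     | n , le , cyc = contradiction cyc (free n (≤-trans (<⇒≤ (≰⇒> ¬le)) le))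
    dom : ∀ i → Any (λ y → Adj G y (s i)) (reachable r v₀)
    dom i with dominates i
    ... | y , y∈ , a′ = Any.map (λ { refl → a′ }) (covered y∈)
  ... | yes (v , v∈ , le) with initial (filter⁺ (λ x → (x ∈? Y) ×-dec adj? G v x) (allFin⁺ (order G))) le
  ...   | q , q∈ , q-inj
    with ramsey-fin {R = λ i j → Adj G (q i) (q j)} (λ i j → adj? G (q i) (q j)) (adj-sym G) a a ≤-refl
  ...     | inj₁ (φ , hom) = inj₂ (clique , t , t-distinct , fan-clique (λ i≢j → proj₂ (hom i≢j)))
    where open Fan v∈ (q ∘ φ) (λ i → proj₁ (neighbours⁻ (q∈ (φ i)))) (λ i → proj₂ (neighbours⁻ (q∈ (φ i))))
                   (λ i≢j → q-inj (proj₁ (hom i≢j)))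
  ...     | inj₂ (φ , hom) = inj₂ (star , t , t-distinct , fan-star (λ i≢j → proj₂ (hom i≢j)))
    where open Fan v∈ (q ∘ φ) (λ i → proj₁ (neighbours⁻ (q∈ (φ i)))) (λ i → proj₂ (neighbours⁻ (q∈ (φ i))))
                   (λ i≢j → q-inj (proj₁ (hom i≢j)))

-- Minimal separators

module _ {G : Graph} where
  open Paths G
  open Components G

  restrict-half : ∀ {κ ℓ k k′ s X} → Half G κ ℓ k s X → (φ : Fin k′ → Fin k) →
                  (∀ {i j} → i ≢ j → φ i ≢ φ j) → Half G κ ℓ k′ (s ∘ φ) X
  restrict-half {κ} P φ inj = record
    { e = e ∘ φ ; tail = tail ∘ φ ; path = λ i → path (φ i) ; joint = joint′ κ joint
    ; long = λ i → long (φ i) ; inside = λ i → inside (φ i)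
    ; cross = λ i≢j x∈ y∈ t → cross′ κ (cross (inj i≢j) x∈ y∈ t) }
    where
    open Half P
    joint′ : ∀ κ {g} → Joint G κ g → Joint G κ (g ∘ φ)
    joint′ star   J i j = J (φ i) (φ j)
    joint′ clique J i≢j = J (inj i≢j)
    cross′ : ∀ κ {g i j x y} {B : Set} → AtEnd G κ g (φ i) (φ j) x y ⊎ B → AtEnd G κ (g ∘ φ) i j x y ⊎ B
    cross′ star   c = c
    cross′ clique c = c

  weaken-half : ∀ {κ ℓ ℓ′ k s X} → ℓ′ ≤ ℓ → Half G κ ℓ k s X → Half G κ ℓ′ k s X
  weaken-half le P = record
    { e = e ; tail = tail ; path = path ; joint = joint ; long = λ i → ≤-trans le (long i)
    ; inside = inside ; cross = cross }
    where open Half P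

  vertex-half : ∀ {k s y X} → X y → (∀ i → Adj G y (s i)) → Half G star 1 k s X
  vertex-half {s = s} {y} Xy adj = record
    { e = λ _ → y ; tail = λ i → [ s i ] ; path = λ i → edge (adj i) ; joint = λ _ _ → refl
    ; long = λ _ → ≤-refl
    ; inside = λ { i (here refl) → inj₂ Xy ; i (there (here x≡)) → inj₁ x≡ }
    ; cross = λ { _ (here x≡) _ _ → inj₁ (inj₁ x≡)
                ; _ (there _) (here y≡) _ → inj₁ (inj₂ y≡)
                ; _ (there (here x≡)) (there (here y≡)) _ → inj₂ (x≡ , y≡) } }

  module _ {k : ℕ} (free : Free (suc k) G) where

    -- The edge counts add up to 2 + 1 for a theta, 2 + 1 or 1 + 1 for a pyramid and 1 + 1 for a
    -- prism. In the third case the halves are exchanged so that the star comes first.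
    ¬stable-halves : ∀ {s X Y} κ κ′ → Half G κ (startLong κ) (suc k) s X → Half G κ′ 1 (suc k) s Y →
                     (∀ {x y} → X x → Y y → ¬ Touch x y) → ¬ (∀ {i j} → i ≢ j → ¬ Touch (s i) (s j))
    ¬stable-halves star star P Q anti st =
      ¬theta free (glue G P Q anti λ i≢j t → contradiction t (st i≢j))
    ¬stable-halves star clique P Q anti st =
      ¬pyramid free (s≤s (s≤s z≤n)) (glue G P Q anti λ i≢j t → contradiction t (st i≢j))
    ¬stable-halves clique star P Q anti st =
      ¬pyramid free ≤-refl (glue G Q P (λ Yx Xy → anti Xy Yx ∘ touch-sym) λ i≢j t → contradiction t (st i≢j))
    ¬stable-halves clique clique P Q anti st =
      ¬prism free (s≤s z≤n) (glue G P Q anti λ i≢j t → contradiction t (st i≢j))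

    -- Here the second half adds no edges, and `startLong` alone suffices: 2 for a pyramid, 1 for a
    -- prism.
    ¬clique-half : ∀ {s X} κ → Half G κ (startLong κ) (suc k) s X → ¬ IsClique G s
    ¬clique-half star   P cl = ¬pyramid free ≤-refl (glue G P (clique-half G cl) (λ _ ()) λ _ _ → refl , refl)
    ¬clique-half clique P cl = ¬prism free ≤-refl (glue G P (clique-half G cl) (λ _ ()) λ _ _ → refl , refl)

startLong≥1 : ∀ κ → 1 ≤ startLong κ
startLong≥1 star   = s≤s z≤n
startLong≥1 clique = ≤-refl

-- Bounded dominating sets

module Bounds (k r : ℕ) where

  -- Chosen backwards: among `stableSize` ends dominated by `farBound` vertices, one vertex sees
  -- `suc k`; among `endsSize` ends there is a clique of size `suc k` or a stable set of size
  -- `stableSize`.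
  farBound stableSize endsSize dominatorBound : ℕ
  farBound       = ballBound (ram (suc k) (suc k)) r
  stableSize     = suc (farBound * suc k)
  endsSize       = ram (suc k) stableSize
  dominatorBound = ballBound (ram endsSize endsSize) r

  module _ {G : Graph} (free : Free (suc k) G) (hole-free : C≥Free r G) where
    open Paths G
    open Components G

    -- A minimal connector inside `L` supplies the second half: either a fan of `suc k` legs, or a
    -- few dominating vertices, one of which sees `suc k` ends and forms a star with single edges as
    -- legs.
    ¬stable-half : ∀ {κ} {s : Fin stableSize → Vertex G} {Y R L} →
                   (∀ {x} → x ∈ Y → x ∈ R) → Half G κ (startLong κ) stableSize s (_∈ Y) →
                   Connector s R → Connector s L → (∀ i → s i ∉ R) → (∀ i → s i ∉ L) →
                   (∀ {x y} → x ∈ R → y ∈ L → ¬ Touch x y) → ¬ (∀ {i j} → i ≢ j → ¬ Touch (s i) (s j))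
    ¬stable-half {κ} {s} Y⊆R P cR cL s∉R s∉L anti st with minimize cL
    ... | Z , Z⊆L , mZ with dichotomy hole-free (suc k)
      where open LongPaths G s mZ (λ i → s∉L i ∘ Z⊆L) cR s∉R (λ x∈ y∈ t → anti y∈ (Z⊆L x∈) (touch-sym t))
    ...   | inj₂ (κ′ , t , t-inj , Q) =
      ¬stable-halves free κ κ′ (restrict-half P t (λ i≢j → t-inj i≢j ∘ cong s))
        (weaken-half (startLong≥1 κ′) Q) (λ x∈ y∈ → anti (Y⊆R x∈) (Z⊆L y∈))
        (λ i≢j → st (λ e → t-inj i≢j (cong s e)))
    ...   | inj₁ (ys , len , ys⊆ , dom)
      with pigeonhole-list (λ y i → adj? G y (s i)) ys (suc k) (allFin stableSize) (allFin⁺ stableSize)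
             (λ {i} _ → dom i)
             (≤-trans (s≤s (*-monoˡ-≤ (suc k) len)) (≤-reflexive (sym (length-tabulate (λ x → x)))))
    ...     | y , φ , y∈ , adj , φ-inj =
      ¬stable-halves free κ star (restrict-half P φ φ-inj) (vertex-half (ys⊆ y∈) adj)
        (λ x∈ y∈ → anti (Y⊆R x∈) (Z⊆L y∈)) (λ i≢j → st (φ-inj i≢j))

    sub-connector : ∀ {m m′} {s : Fin m → Vertex G} {X} (t : Fin m′ → Fin m) → Connector s X → Connector (s ∘ t) X
    sub-connector t c = record { connected = Connector.connected c ; dominates = Connector.dominates c ∘ t }

    -- The alternative in `dichotomy` is a half with `endsSize` legs, and by Ramsey its ends contain
    -- a clique or a stable set, both already excluded.
    dominator : ∀ {m} {s : Fin m → Vertex G} {R L} → Connector s R → Connector s L →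
                (∀ i → s i ∉ R) → (∀ i → s i ∉ L) → (∀ {x y} → x ∈ R → y ∈ L → ¬ Touch x y) →
                ∃[ ys ] (length ys ≤ dominatorBound × (∀ {y} → y ∈ˡ ys → y ∈ R) ×
                         (∀ i → Any (λ y → Adj G y (s i)) ys))
    dominator {s = s} cR cL s∉R s∉L anti with minimize cR
    ... | Y , Y⊆R , mY with dichotomy hole-free endsSize
      where open LongPaths G s mY (λ i → s∉R i ∘ Y⊆R) cL s∉L (λ x∈ y∈ → anti (Y⊆R x∈) y∈)
    ...   | inj₁ (ys , len , ys⊆ , dom) = ys , len , Y⊆R ∘ ys⊆ , dom
    ...   | inj₂ (κ , t , t-inj , P)
      with ramsey-fin {R = λ i j → Adj G (s (t i)) (s (t j))} (λ i j → adj? G (s (t i)) (s (t j))) (adj-sym G)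
             (suc k) stableSize ≤-refl
    ...     | inj₁ (φ , hom) = ⊥-elim (¬clique-half free κ (restrict-half P φ (λ i≢j → proj₁ (hom i≢j)))
                                         (λ i≢j → proj₂ (hom i≢j)))
    ...     | inj₂ (φ , hom) = ⊥-elim (¬stable-half Y⊆R (restrict-half P φ (λ i≢j → proj₁ (hom i≢j)))
      (sub-connector (t ∘ φ) cR) (sub-connector (t ∘ φ) cL) (s∉R ∘ t ∘ φ) (s∉L ∘ t ∘ φ) anti
      (λ { i≢j (inj₁ e) → t-inj (proj₁ (hom i≢j)) e ; i≢j (inj₂ a) → proj₂ (hom i≢j) a }))

-- Encoding minimal separators by tuples of vertices

subset : ∀ {n} {P : Pred (Fin n) 0ℓ} → U.Decidable P → Subset n
subset P? = tabulate (does ∘ P?)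

∈-subset⁺ : ∀ {n} {P : Pred (Fin n) 0ℓ} (P? : U.Decidable P) {x} → P x → x ∈ subset P?
∈-subset⁺ P? {x} Px = lookup⇒[]= x _ (trans (lookup∘tabulate _ x) (dec-true (P? x) Px))

∈-subset⁻ : ∀ {n} {P : Pred (Fin n) 0ℓ} (P? : U.Decidable P) {x} → x ∈ subset P? → P x
∈-subset⁻ P? {x} x∈ with P? x | trans (sym (lookup∘tabulate (does ∘ P?) x)) ([]=⇒lookup x∈)
... | yes Px | _ = Px

-- The last entry is repeated as padding, so that all dominating sets become tuples of the same
-- length.
enumerate : ∀ {A : Set} {c} (x : A) xs → length (x ∷ xs) ≤ c →
            Σ[ f ∈ (Fin c → A) ] ((∀ i → f i ∈ˡ x ∷ xs) × (∀ {y} → y ∈ˡ x ∷ xs → ∃[ i ] f i ≡ y))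
enumerate x []       (s≤s _)  = (λ _ → x) , (λ _ → here refl) , λ { (here refl) → zero , refl }
enumerate x (y ∷ ys) (s≤s le) with enumerate y ys le
... | f , f∈ , f-onto = g , g∈ , g-onto
  where
  g : Fin _ → _
  g zero    = x
  g (suc i) = f i
  g∈ : ∀ i → g i ∈ˡ x ∷ y ∷ ys
  g∈ zero    = here refl
  g∈ (suc i) = there (f∈ i)
  g-onto : ∀ {z} → z ∈ˡ x ∷ y ∷ ys → ∃[ i ] g i ≡ z
  g-onto (here refl) = zero , refl
  g-onto (there z∈) with f-onto z∈
  ... | i , eq = suc i , eq

module Separators (G : Graph) where
  open Paths G
  open Components G

  component⊆ : ∀ {U C} → IsComponent G U C → ∀ {x} → x ∈ C → x ∈ U
  component⊆ {U} (v , v∈ , to , from) x∈ = go v∈ (to x∈)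
    where
    go : ∀ {u x} → u ∈ U → Star (AdjWithin G U) u x → x ∈ U
    go u∈ ε = u∈
    go u∈ ((_ , w∈ , _) ◅ st) = go w∈ st

  component-closed : ∀ {U C} → IsComponent G U C → Closed U C
  component-closed comp@(_ , _ , to , from) x∈ y∈ a =
    from (to x∈ ◅◅ (component⊆ comp x∈ , y∈ , a) ◅ ε)

  component-connected : ∀ {U C} → IsComponent G U C → Connected C
  component-connected comp@(v , v∈ , to , from) =
    v , from ε , λ x∈ → proj₂ (closed-star (component-closed comp) (from ε) (to x∈))

  components-meet : ∀ {U C D x} → IsComponent G U C → IsComponent G U D → x ∈ C → x ∈ D → C ≡ D
  components-meet (v , _ , to , from) (v′ , _ , to′ , from′) x∈C x∈D = ⊆-antisym
    (λ y∈ → from′ (to′ x∈D ◅◅ flip-star (to x∈C) ◅◅ to y∈))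
    (λ y∈ → from (to x∈C ◅◅ flip-star (to′ x∈D) ◅◅ to′ y∈))

  components-anticomplete : ∀ {U C D} → IsComponent G U C → IsComponent G U D → C ≢ D →
                            ∀ {x y} → x ∈ C → y ∈ D → ¬ Touch x y
  components-anticomplete c d C≢D x∈ y∈ (inj₁ refl) = C≢D (components-meet c d x∈ y∈)
  components-anticomplete c d C≢D x∈ y∈ (inj₂ a) =
    C≢D (components-meet c d (component-closed c x∈ (component⊆ d y∈) a) y∈)

  -- Two c-tuples encode the set of vertices with a neighbour in each.
  module Code (c : ℕ) where

    Common : (Fin (c + c) → Vertex G) → Pred (Vertex G) 0ℓ
    Common h x = (∃[ i ] Adj G (h (i ↑ˡ c)) x) × (∃[ j ] Adj G (h (c ↑ʳ j)) x)

    common? : ∀ h → U.Decidable (Common h)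
    common? h x = anyᶠ? (λ i → adj? G (h (i ↑ˡ c)) x) ×-dec anyᶠ? (λ j → adj? G (h (c ↑ʳ j)) x)

    decode : Fin (order G ^ (c + c)) → Subset (order G)
    decode code = subset (common? (finToFun code))

    encode : ∀ {S} (f g : Fin c → Vertex G) →
             (∀ {x} → (∃[ i ] Adj G (f i) x) → (∃[ j ] Adj G (g j) x) → x ∈ S) →
             (∀ {x} → x ∈ S → (∃[ i ] Adj G (f i) x) × (∃[ j ] Adj G (g j) x)) →
             ∃[ code ] decode code ≡ S
    encode {S} f g sound complete = funToFin h , ⊆-antisym ⊆S S⊆
      where
      h : Fin (c + c) → Vertex G
      h = [ f , g ]′ ∘ splitAt c
      left : ∀ i → finToFun (funToFin h) (i ↑ˡ c) ≡ f i
      left i = trans (finToFun-funToFin h (i ↑ˡ c)) (cong [ f , g ]′ (splitAt-↑ˡ c i c))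
      right : ∀ j → finToFun (funToFin h) (c ↑ʳ j) ≡ g j
      right j = trans (finToFun-funToFin h (c ↑ʳ j)) (cong [ f , g ]′ (splitAt-↑ʳ c c j))
      ⊆S : ∀ {x} → x ∈ decode (funToFin h) → x ∈ S
      ⊆S x∈ with ∈-subset⁻ (common? (finToFun (funToFin h))) x∈
      ... | (i , a) , (j , b) =
        sound (i , subst (λ z → Adj G z _) (left i) a) (j , subst (λ z → Adj G z _) (right j) b)
      S⊆ : ∀ {x} → x ∈ S → x ∈ decode (funToFin h)
      S⊆ x∈ with complete x∈
      ... | (i , a) , (j , b) = ∈-subset⁺ (common? (finToFun (funToFin h)))
        ((i , subst (λ z → Adj G z _) (sym (left i)) a) , (j , subst (λ z → Adj G z _) (sym (right j)) b))

  separator-code : ∀ {k r S} → Free (suc k) G → C≥Free r G → IsMinimalSeparator G S →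
                   ∃[ code ] Code.decode (Bounds.dominatorBound k r) code ≡ S
  separator-code {k} {r} {S} free hole-free sep
    with tuple connectorL connectorR s∉L s∉R antiLR
       | tuple connectorR connectorL s∉R s∉L (λ x∈ y∈ → antiLR y∈ x∈ ∘ touch-sym)
    where
    open IsMinimalSeparator sep
    vs : List (Vertex G)
    vs = filter (_∈? S) (allFin (order G))
    s : Fin (length vs) → Vertex G
    s = lookup vs
    s∈S : ∀ i → s i ∈ S
    s∈S i = proj₂ (∈-filter⁻ (_∈? S) {xs = allFin (order G)} (∈-lookup i))
    antiLR : ∀ {x y} → x ∈ L → y ∈ R → ¬ Touch x y
    antiLR = components-anticomplete L-component R-component L≢R
    s∉L : ∀ i → s i ∉ L
    s∉L i = proj₁ (proj₂ N[L]≐S (s∈S i))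
    s∉R : ∀ i → s i ∉ R
    s∉R i = proj₁ (proj₂ N[R]≐S (s∈S i))
    connectorL : Connector s L
    connectorL = record
      { connected = component-connected L-component
      ; dominates = λ i → proj₂ (proj₂ N[L]≐S (s∈S i)) }
    connectorR : Connector s R
    connectorR = record
      { connected = component-connected R-component
      ; dominates = λ i → proj₂ (proj₂ N[R]≐S (s∈S i)) }
    tuple : ∀ {X Y} → Connector s X → Connector s Y → (∀ i → s i ∉ X) → (∀ i → s i ∉ Y) →
            (∀ {x y} → x ∈ X → y ∈ Y → ¬ Touch x y) →
            Σ[ f ∈ (Fin (Bounds.dominatorBound k r) → Vertex G) ]
              ((∀ i → f i ∈ X) × (∀ {x} → x ∈ S → ∃[ i ] Adj G (f i) x))
    tuple cX cY s∉X s∉Y anti with Bounds.dominator k r free hole-free cX cY s∉X s∉Y anti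
    ... | [] , _ , _ , dom with dom (index (∈-filter⁺ (_∈? S) (∈-allFin _) (proj₂ nonempty)))
    ...   | ()
    tuple cX cY s∉X s∉Y anti | y ∷ ys , len , ys⊆ , dom with enumerate y ys len
    ... | f , f∈ , onto = f , ys⊆ ∘ f∈ , λ x∈ → dominated (∈-filter⁺ (_∈? S) (∈-allFin _) x∈)
      where
      dominated : ∀ {x} → x ∈ˡ vs → ∃[ i ] Adj G (f i) x
      dominated x∈ with find (dom (index x∈))
      ... | z , z∈ , a with onto z∈
      ...   | i , refl = i , subst (Adj G _) (sym (lookup-index x∈)) a
  ... | f , f∈L , f-dom | g , g∈R , g-dom =
    Code.encode (Bounds.dominatorBound k r) f g sound (λ x∈ → f-dom x∈ , g-dom x∈)
    where
    open IsMinimalSeparator sep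
    -- A vertex with neighbours in both L and R cannot lie in L, which is anti-complete to R; hence
    -- it belongs to N(L) = S.
    sound : ∀ {x} → (∃[ i ] Adj G (f i) x) → (∃[ j ] Adj G (g j) x) → x ∈ S
    sound (i , a) (j , b) = proj₁ N[L]≐S
      ((λ x∈L → components-anticomplete L-component R-component L≢R x∈L (g∈R j) (inj₂ (adj-sym G b)))
      , _ , f∈L i , a)

-- The empty graph is a 0-prism and embeds in every graph, so for k = 0 the family is empty.
¬prism-free-0 : ∀ {G} → ¬ PrismFree 0 G
¬prism-free-0 free = free H prism (record { to = λ () ; injective = λ { {()} } ; adj⇔adj = λ () })
  where
  H : Graph
  H = record { order = 0 ; Adj = λ _ _ → ⊥ ; adj? = λ () ; adj-sym = λ () ; adj-irrefl = λ () }
  prism : IsPrism 0 H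
  prism = record
    { a = λ () ; b = λ () ; a-clique = λ { {()} } ; b-clique = λ { {()} } ; a≢b = λ () ; path = λ ()
    ; length≥2 = λ () ; disjoint = λ { {()} } ; cross = λ { {()} } ; covers = λ () }

theorem3 : (k r : ℕ) →
    Tame (λ G → C≥Free r G × ThetaFree k G × PrismFree k G × PyramidFree k G)
theorem3 zero    r = 0 , λ G (_ , _ , prism-free , _) → ⊥-elim (¬prism-free-0 prism-free)
-- The exponent counts the entries of two `c`-tuples, one from each of L and R.
theorem3 (suc k) r = c + c , λ G (hole-free , theta-free , prism-free , pyramid-free) →
  encoded⇒atMost (Separators.Code.decode G c) (Separators.separator-code G
    (record { theta-free = theta-free ; prism-free = prism-free ; pyramid-free = pyramid-free }) hole-free)
  where c = Bounds.dominatorBound k r
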